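{- For every integer $k\geq 1$, $$\vert\, \kappa_{2k-1,2k+1}\,\vert = 4\,\vert\, \kappa_{2k-1,2k,2k+1}\,\vert ,$$ where $\kappa_{2k-1,2k+1}$ denotes the (unique) $(2k-1,2k+1)$-core partition of largest size and $\kappa_{2k-1,2k,2k+1}$ denotes a $(2k-1,2k,2k+1)$-core partition of largest size.
   Context: For a partition $\lambda$, $|\lambda|$ denotes the integer it partitions (the sum of its parts). The hook of a box in the Young diagram of $\lambda$ consists of the box itself together with the boxes to its right in the same row and below it in the same column; its hook length is the number of these boxes. For a positive integer $t$, a $t$-core is a partition with no hook of length $t$. For positive integers $s_1,\dots,s_m$, an $(s_1,\dots,s_m)$-core is a partition that is simultaneously an $s_i$-core for every $i$. When $\gcd(s_1,\dots,s_m)=1$ there are only finitely many such cores, so cores of maximal size exist; for coprime $s,t$ the $(s,t)$-core of maximal size is unique. -}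

module Defs where

open import Data.Nat using (ℕ; zero; suc; _+_; _∸_; _≤_; _≥_; _<_; _<?_)
open import Data.List using (List; []; _∷_; length; filter)
open import Data.Nat.ListAction using (sum)
open import Data.List.Relation.Unary.All using (All)
open import Data.List.Relation.Unary.Linked using (Linked)
open import Relation.Binary.PropositionalEquality using (_≡_)
open import Relation.Nullary using (¬_)
open import Data.Product using (_×_)

record Partition : Set where
  constructor mkPartition
  field
    parts      : List ℕ
    decreasing : Linked _≥_ parts
    positive   : All (λ p → 0 < p) parts
open Partition public

size : Partition → ℕ
size λ′ = sum (parts λ′)

rowLen : List ℕ → ℕ → ℕ
rowLen []       _       = 0
rowLen (p ∷ ps) zero    = p
rowLen (p ∷ ps) (suc i) = rowLen ps i

colLen : List ℕ → ℕ → ℕ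
colLen ps j = length (filter (j <?_) ps)

InDiagram : Partition → ℕ → ℕ → Set
InDiagram λ′ i j = j < rowLen (parts λ′) i

-- hook length of box (i , j): (boxes to the right) + (boxes below) + 1
--   = (λ_i - j) + (λ'_j - i) - 1
hookLength : Partition → ℕ → ℕ → ℕ
hookLength λ′ i j = ((rowLen (parts λ′) i ∸ j) + (colLen (parts λ′) j ∸ i)) ∸ 1

IsCore : ℕ → Partition → Set
IsCore t λ′ = ∀ i j → InDiagram λ′ i j → ¬ (hookLength λ′ i j ≡ t)

Is2Core : ℕ → ℕ → Partition → Set
Is2Core s t λ′ = IsCore s λ′ × IsCore t λ′

Is3Core : ℕ → ℕ → ℕ → Partition → Set
Is3Core r s t λ′ = IsCore r λ′ × IsCore s λ′ × IsCore t λ′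

IsLargest : (Partition → Set) → Partition → Set
IsLargest P λ′ = P λ′ × (∀ μ → P μ → size μ ≤ size λ′)

{-# OPTIONS --safe #-}

-- A partition is encoded by the set of its first-column hook lengths (beads); it is a t-core
-- exactly when no bead lies t above a gap, and twice its size is Σ (2x + 1) − m² over its m beads x.
--
-- One inequality, on sequences of small spread, drives both upper bounds. For a (2k−1, 2k+1)-core
-- let ν count, runner by runner modulo 2k−1, the gaps of the numerical semigroup generated by 2k−1
-- and 2k+1 that are missing from the bead set. In the order 0, t, 2t, … of the runners (t = 2k+1)
-- ν is nondecreasing with values in [0, t], and the maximal size exceeds the size by half of
-- Σ_{p<q} (ν_q − ν_p)(t − (ν_q − ν_p)) ≥ 0.
--
-- For a (2k−1, 2k, 2k+1)-core cut the bead set into rows of length 2k. Pushing beads to the right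
-- end of their rows bounds the size by a concave function of the row counts r_j, which satisfy
-- r_{j+1} + 2 ≤ r_j. With J nonempty rows, measuring the r_j against the progression J + k − 2(j+1)
-- again gives a sequence of small spread, so the same inequality shows that this progression is
-- optimal; its value increases with J ≤ k − 1 and ends at k²(k² − 1)/6.
module Submission where

open import Data.Bool using (Bool; true; false; if_then_else_; _∨_)
open import Data.Empty using (⊥; ⊥-elim)
open import Data.List using (List; []; _∷_; length)
open import Data.List.Properties using (filter-accept; filter-reject)
open import Data.List.Relation.Unary.All as All using (All; []; _∷_)
open import Data.List.Relation.Unary.Linked as Linked using (Linked; []; [-]; _∷_)
open import Data.Nat.ListAction using (sum)
import Data.Nat.Tactic.RingSolver as ℕSolver
open import Data.Product using (_×_; ∃; _,_)
open import Data.Sum using (inj₁; inj₂)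
open import Defs
open import Function using (_∘_)
open import Relation.Binary.PropositionalEquality hiding (J)
open import Relation.Nullary using (contradiction)

-- Bead sets, the partitions they encode, and hook lengths

module Beads where

  open import Data.Bool using (T)
  open import Data.Nat
  open import Data.Nat.Properties

  beads gaps : (ℕ → Bool) → ℕ → ℕ
  beads χ zero    = 0
  beads χ (suc n) = if χ n then suc (beads χ n) else beads χ n
  gaps χ zero    = 0
  gaps χ (suc n) = if χ n then gaps χ n else suc (gaps χ n)

  -- Each bead is a row and each gap below it is a column crossing that row, hence the gap count as
  -- row length. Descending from the top bead lists the parts in decreasing order.
  shape : (ℕ → Bool) → ℕ → List ℕ
  shape χ zero    = []
  shape χ (suc n) = if χ n then gaps χ n ∷ shape χ n else shape χ n

  -- The core condition on beads, stated upwards from a gap so that truncated subtraction never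
  -- enters.
  Closed : ℕ → (ℕ → Bool) → Set
  Closed t χ = ∀ y → χ y ≡ false → χ (y + t) ≡ false

  gaps+beads : ∀ χ n → gaps χ n + beads χ n ≡ n
  gaps+beads χ zero = refl
  gaps+beads χ (suc n) with χ n
  ... | true  = trans (+-suc _ _) (cong suc (gaps+beads χ n))
  ... | false = cong suc (gaps+beads χ n)

  beads≤ : ∀ χ n → beads χ n ≤ n
  beads≤ χ n = subst (beads χ n ≤_) (gaps+beads χ n) (m≤n+m _ _)

  step-mono : (f : ℕ → ℕ) → (∀ n → f n ≤ f (suc n)) → ∀ {m n} → m ≤ n → f m ≤ f n
  step-mono f step {m} {zero} z≤n = ≤-refl
  step-mono f step {m} {suc n} m≤1+n with m≤n⇒m<n∨m≡n m≤1+n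
  ... | inj₁ (s≤s m≤n) = ≤-trans (step-mono f step m≤n) (step n)
  ... | inj₂ refl = ≤-refl

  gaps-mono : ∀ χ {m n} → m ≤ n → gaps χ m ≤ gaps χ n
  gaps-mono χ = step-mono (gaps χ) step
    where
    step : ∀ n → gaps χ n ≤ gaps χ (suc n)
    step n with χ n
    ... | true  = ≤-refl
    ... | false = n≤1+n _

  beads-mono : ∀ χ {m n} → m ≤ n → beads χ m ≤ beads χ n
  beads-mono χ = step-mono (beads χ) step
    where
    step : ∀ n → beads χ n ≤ beads χ (suc n)
    step n with χ n
    ... | true  = n≤1+n _
    ... | false = ≤-refl

  beads-bead : ∀ χ {x} → χ x ≡ true → beads χ (suc x) ≡ suc (beads χ x)
  beads-bead χ eq rewrite eq = refl

  beads-gap : ∀ χ {x} → χ x ≡ false → beads χ (suc x) ≡ beads χ x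
  beads-gap χ eq rewrite eq = refl

  gaps-gap : ∀ χ {x} → χ x ≡ false → gaps χ (suc x) ≡ suc (gaps χ x)
  gaps-gap χ eq rewrite eq = refl

  gaps-strict : ∀ χ {y x} → χ y ≡ false → y < x → gaps χ y < gaps χ x
  gaps-strict χ eq y<x = ≤-trans (≤-reflexive (sym (gaps-gap χ eq))) (gaps-mono χ y<x)

  bead≢gap : ∀ {χ : ℕ → Bool} {x} → χ x ≡ true → χ x ≡ false → ⊥
  bead≢gap p q with trans (sym p) q
  ... | ()

  beads-none⁻¹ : ∀ f n → beads f n ≡ 0 → ∀ i → i < n → f i ≡ false
  beads-none⁻¹ f n none i i<n with f i in fi
  ... | false = refl
  ... | true with subst₂ _≤_ (beads-bead f fi) none (beads-mono f i<n)
  ...   | ()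

  beads-none : ∀ f n → (∀ i → f i ≡ false) → beads f n ≡ 0
  beads-none f zero    none = refl
  beads-none f (suc n) none rewrite none n = beads-none f n none

  gap-contrapositive : ∀ {a b : Bool} → (a ≡ false → b ≡ false) → b ≡ true → a ≡ true
  gap-contrapositive {true}  _   _  = refl
  gap-contrapositive {false} imp b≡ with trans (sym b≡) (imp refl)
  ... | ()

  shape-bounded : ∀ χ n → All (_≤ gaps χ n) (shape χ n)
  shape-bounded χ zero = []
  shape-bounded χ (suc n) with χ n
  ... | true  = ≤-refl ∷ shape-bounded χ n
  ... | false = All.map m≤n⇒m≤1+n (shape-bounded χ n)

  shape-linked : ∀ χ n → Linked _≥_ (shape χ n)
  shape-linked χ zero = []
  shape-linked χ (suc n) with χ n
  ... | false = shape-linked χ n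
  ... | true  = cons (shape-bounded χ n) (shape-linked χ n)
    where
    cons : ∀ {g ps} → All (_≤ g) ps → Linked _≥_ ps → Linked _≥_ (g ∷ ps)
    cons []      _  = [-]
    cons (p ∷ _) ls = p ∷ ls

  -- The gap at 0 lies below every bead, so every row has a box.
  shape-positive : ∀ χ → χ 0 ≡ false → ∀ n → All (0 <_) (shape χ n)
  shape-positive χ χ0 zero = []
  shape-positive χ χ0 (suc n) with χ n in χn
  ... | false = shape-positive χ χ0 n
  ... | true  = gaps-strict χ χ0 0<n ∷ shape-positive χ χ0 n
    where
    0<n : 0 < n
    0<n = n≢0⇒n>0 λ { refl → bead≢gap {χ} χn χ0 }

  toPartition : ∀ χ → χ 0 ≡ false → ℕ → Partition
  toPartition χ χ0 n = mkPartition (shape χ n) (shape-linked χ n) (shape-positive χ χ0 n)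

  -- Rows are numbered from the top bead, and the additive equation expresses that exactly `i` beads
  -- lie above `x`.
  rowLen-shape : ∀ χ n {x i} → χ x ≡ true → x < n → beads χ (suc x) + i ≡ beads χ n →
                 rowLen (shape χ n) i ≡ gaps χ x
  rowLen-shape χ (suc n) {x} {i} χx x<1+n eq with m≤n⇒m<n∨m≡n x<1+n
  rowLen-shape χ (suc n) {x} {i} χx _ eq | inj₂ refl with i | +-cancelˡ-≡ (beads χ (suc n)) i 0 (trans eq (sym (+-identityʳ _)))
  ... | .0 | refl rewrite χx = refl
  rowLen-shape χ (suc n) {x} {i} χx _ eq | inj₁ (s≤s x<n) with χ n
  ... | false = rowLen-shape χ n χx x<n eq
  rowLen-shape χ (suc n) {x} {zero} χx _ eq | inj₁ (s≤s x<n) | true =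
    contradiction (beads-mono χ x<n) (<⇒≱ (≤-reflexive (trans (sym eq) (+-identityʳ _))))
  rowLen-shape χ (suc n) {x} {suc i} χx _ eq | inj₁ (s≤s x<n) | true =
    rowLen-shape χ n χx x<n (suc-injective (trans (sym (+-suc _ i)) eq))

  row-bead : ∀ χ n {i j} → j < rowLen (shape χ n) i →
             ∃ λ x → χ x ≡ true × x < n × beads χ (suc x) + i ≡ beads χ n
  row-bead χ (suc n) {i} lt with χ n in χn
  row-bead χ (suc n) {i} lt | false =
    let x , χx , x<n , eq = row-bead χ n {i} lt in x , χx , m<n⇒m<1+n x<n , eq
  row-bead χ (suc n) {zero} lt | true =
    n , χn , ≤-refl , trans (+-identityʳ _) (beads-bead χ χn)
  row-bead χ (suc n) {suc i} lt | true =
    let x , χx , x<n , eq = row-bead χ n {i} lt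
    in x , χx , m<n⇒m<1+n x<n , trans (+-suc _ i) (cong suc eq)

  column-gap : ∀ χ x {j} → j < gaps χ x → ∃ λ y → χ y ≡ false × y < x × gaps χ y ≡ j
  column-gap χ (suc x) {j} lt with χ x in χx
  ... | true = let y , χy , y<x , eq = column-gap χ x lt in y , χy , m<n⇒m<1+n y<x , eq
  ... | false with m≤n⇒m<n∨m≡n lt
  ...   | inj₁ (s≤s j<g) = let y , χy , y<x , eq = column-gap χ x j<g in y , χy , m<n⇒m<1+n y<x , eq
  ...   | inj₂ refl = x , χx , ≤-refl , refl

  colLen-bounded : ∀ {ps j} → All (_≤ j) ps → colLen ps j ≡ 0
  colLen-bounded [] = refl
  colLen-bounded {p ∷ ps} {j} (p≤j ∷ ps≤j) =
    trans (cong length (filter-reject (j <?_) (≤⇒≯ p≤j))) (colLen-bounded ps≤j)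

  -- A row is longer than `gaps χ y` exactly when its bead lies above the gap `y`, so this column
  -- meets the beads above `y` and no others.
  colLen-shape : ∀ χ n {y} → χ y ≡ false → y < n →
                 beads χ y + colLen (shape χ n) (gaps χ y) ≡ beads χ n
  colLen-shape χ (suc n) {y} χy y<1+n with m≤n⇒m<n∨m≡n y<1+n
  ... | inj₂ refl rewrite χy | colLen-bounded (shape-bounded χ n) = +-identityʳ _
  ... | inj₁ (s≤s y<n) with χ n
  ...   | false = colLen-shape χ n χy y<n
  ...   | true
    rewrite filter-accept (gaps χ y <?_) {xs = shape χ n} (gaps-strict χ χy y<n)
    = trans (+-suc _ _) (cong suc (colLen-shape χ n χy y<n))

  -- For a bead x = y + t above a gap y, `gx ∸ gy` counts the gaps in
  -- [y, x) and `c ∸ i` the beads in (y, x]. Together they exhaust the t + 1 positions from y to x.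
  hook-arith : ∀ {gx bx gy by y t c i C} → gx + bx ≡ y + t → gy + by ≡ y → gy ≤ gx → by ≤ bx →
               suc bx + i ≡ C → by + c ≡ C → ((gx ∸ gy) + (c ∸ i)) ∸ 1 ≡ t
  hook-arith {gx} {bx} {gy} {by} {y} {t} {c} {i} e₁ e₂ gy≤gx by≤bx e₃ e₄ =
    cong (_∸ 1) (trans (sym (+-∸-assoc a i≤c)) (trans (cong (_∸ i) a+c≡) (m+n∸n≡m (suc t) i)))
    where
    a = gx ∸ gy
    gx≡ : gx ≡ a + gy
    gx≡ = sym (m∸n+n≡m gy≤gx)
    a+bx≡by+t : a + bx ≡ by + t
    a+bx≡by+t = +-cancelˡ-≡ gy _ _ (begin
      gy + (a + bx) ≡⟨ solve₁ gy a bx ⟩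
      a + gy + bx   ≡⟨ cong (_+ bx) gx≡ ⟨
      gx + bx       ≡⟨ e₁ ⟩
      y + t         ≡⟨ cong (_+ t) e₂ ⟨
      gy + by + t   ≡⟨ +-assoc gy by t ⟩
      gy + (by + t) ∎)
      where
      open ≡-Reasoning
      solve₁ : ∀ a b c → a + (b + c) ≡ b + a + c
      solve₁ = ℕSolver.solve-∀
    a+c≡ : a + c ≡ suc t + i
    a+c≡ = +-cancelˡ-≡ by _ _ (begin
      by + (a + c)       ≡⟨ solve₁ by a c ⟩
      a + (by + c)       ≡⟨ cong (a +_) (trans e₄ (sym e₃)) ⟩
      a + (suc bx + i)   ≡⟨ solve₂ a bx i ⟩
      suc (a + bx) + i   ≡⟨ cong (λ z → suc z + i) a+bx≡by+t ⟩
      suc (by + t) + i   ≡⟨ solve₂ by t i ⟨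
      by + (suc t + i)   ∎)
      where
      open ≡-Reasoning
      solve₁ : ∀ a b c → a + (b + c) ≡ b + (a + c)
      solve₁ = ℕSolver.solve-∀
      solve₂ : ∀ a b c → a + (suc b + c) ≡ suc (a + b) + c
      solve₂ = ℕSolver.solve-∀
    i≤c : i ≤ c
    i≤c = +-cancelˡ-≤ by _ _ (begin
      by + i     ≤⟨ +-monoˡ-≤ i (m≤n⇒m≤1+n by≤bx) ⟩
      suc bx + i ≡⟨ trans e₃ (sym e₄) ⟩
      by + c     ∎)
      where open ≤-Reasoning

  -- The bead x is a row, the gap y < x is a column, and their common box has hook length x − y.
  hookLength-shape : ∀ χ {χ0} n {y t i} → χ y ≡ false → χ (y + t) ≡ true → y + t < n →
                     beads χ (suc (y + t)) + i ≡ beads χ n →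
                     hookLength (toPartition χ χ0 n) i (gaps χ y) ≡ t
  hookLength-shape χ n {y} {t} {i} χy χx x<n eq
    rewrite rowLen-shape χ n {i = i} χx x<n eq =
    hook-arith (gaps+beads χ (y + t)) (gaps+beads χ y)
      (gaps-mono χ (m≤m+n y t)) (beads-mono χ (m≤m+n y t))
      (trans (cong (_+ i) (sym (beads-bead χ χx))) eq)
      (colLen-shape χ n χy (≤-<-trans (m≤m+n y t) x<n))

  -- Every box comes from a bead and a gap below it, and its hook length is their distance; a hook
  -- of length `t` would place a bead `t` above a gap.
  closed⇒core : ∀ χ {χ0} n {t} → Closed t χ → IsCore t (toPartition χ χ0 n)
  closed⇒core χ {χ0} n {t} closed i j j<row hook≡t
    with row-bead χ n {i} j<row
  ... | x , χx , x<n , eq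
    with column-gap χ x (subst (j <_) (rowLen-shape χ n χx x<n eq) j<row)
  ... | y , χy , y<x , refl
    with m≤n⇒∃[o]m+o≡n (<⇒≤ y<x)
  ... | d , refl
    with trans (sym (hookLength-shape χ {χ0} n {i = i} χy χx x<n eq)) hook≡t
  ... | refl = bead≢gap {χ} χx (closed y χy)

  -- A bead `t` above a gap yields a box with the forbidden hook length. The bound places that bead
  -- inside the window, and `0 < t` puts the gap strictly below it.
  core⇒closed : ∀ χ {χ0} n {t} → 0 < t → (∀ x → n ≤ x → χ x ≡ false) →
                IsCore t (toPartition χ χ0 n) → Closed t χ
  core⇒closed χ {χ0} n {t} 0<t bound core y χy with χ (y + t) in χx
  ... | false = refl
  ... | true  = contradiction (hookLength-shape χ {χ0} n {i = i} χy χx x<n eq)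
      (core i (gaps χ y) (subst (gaps χ y <_) (sym (rowLen-shape χ n χx x<n eq)) (gaps-strict χ χy y<x)))
    where
    x<n : y + t < n
    x<n = ≰⇒> λ n≤x → bead≢gap {χ} χx (bound _ n≤x)
    y<x : y < y + t
    y<x = subst (_≤ y + t) (+-comm y 1) (+-monoʳ-≤ y 0<t)
    i = beads χ n ∸ beads χ (suc (y + t))
    eq : beads χ (suc (y + t)) + i ≡ beads χ n
    eq = m+[n∸m]≡n (beads-mono χ x<n)

  -- From a partition to its bead set

  beadSet : List ℕ → ℕ → Bool
  beadSet []       x = false
  -- The first box of this row has p boxes in its row, itself included, and `length ps` boxes below
  -- it, so its hook length is `p + length ps`.
  beadSet (p ∷ ps) x = (x ≡ᵇ p + length ps) ∨ beadSet ps x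

  beadBound : List ℕ → ℕ
  beadBound []       = 0
  beadBound (p ∷ ps) = suc (p + length ps)

  ≡ᵇ-refl : ∀ n → (n ≡ᵇ n) ≡ true
  ≡ᵇ-refl zero    = refl
  ≡ᵇ-refl (suc n) = ≡ᵇ-refl n

  ≢⇒≡ᵇ-false : ∀ {m n} → m ≢ n → (m ≡ᵇ n) ≡ false
  ≢⇒≡ᵇ-false {m} {n} m≢n with m ≡ᵇ n in eq
  ... | false = refl
  ... | true  = contradiction (≡ᵇ⇒≡ m n (subst T (sym eq) _)) m≢n

  -- Weakly decreasing parts have strictly decreasing first-column hook lengths, so the remaining
  -- beads all lie below the top one.
  beadBound-tail : ∀ {p ps} → Linked _≥_ (p ∷ ps) → beadBound ps ≤ p + length ps
  beadBound-tail {p} [-] = z≤n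
  beadBound-tail {p} {q ∷ ps} (p≥q ∷ _) = subst (suc (q + length ps) ≤_) (sym (+-suc p _)) (s≤s (+-monoˡ-≤ _ p≥q))

  beadSet-bound : ∀ {ps} → Linked _≥_ ps → ∀ x → beadBound ps ≤ x → beadSet ps x ≡ false
  beadSet-bound {[]} _ x _ = refl
  beadSet-bound {p ∷ ps} ls x b≤x rewrite ≢⇒≡ᵇ-false (≢-sym (<⇒≢ b≤x)) =
    beadSet-bound (Linked.tail ls) x (≤-trans (beadBound-tail ls) (<⇒≤ b≤x))

  beadSet-0 : ∀ {ps} → All (0 <_) ps → beadSet ps 0 ≡ false
  beadSet-0 [] = refl
  beadSet-0 (s≤s z≤n ∷ ps) = beadSet-0 ps

  gaps-cong : ∀ {χ χ′} n → (∀ x → x < n → χ x ≡ χ′ x) → gaps χ n ≡ gaps χ′ n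
  gaps-cong zero eq = refl
  gaps-cong {χ} {χ′} (suc n) eq
    rewrite eq n ≤-refl | gaps-cong {χ} {χ′} n (λ x x<n → eq x (m<n⇒m<1+n x<n)) = refl

  shape-cong : ∀ {χ χ′} n → (∀ x → x < n → χ x ≡ χ′ x) → shape χ n ≡ shape χ′ n
  shape-cong zero eq = refl
  shape-cong {χ} {χ′} (suc n) eq
    rewrite eq n ≤-refl
          | gaps-cong {χ} {χ′} n (λ x x<n → eq x (m<n⇒m<1+n x<n))
          | shape-cong {χ} {χ′} n (λ x x<n → eq x (m<n⇒m<1+n x<n)) = refl

  length-shape : ∀ χ n → length (shape χ n) ≡ beads χ n
  length-shape χ zero = refl
  length-shape χ (suc n) with χ n
  ... | true  = cong suc (length-shape χ n)
  ... | false = length-shape χ n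

  shape-stable : ∀ {χ m n} → m ≤ n → (∀ x → m ≤ x → χ x ≡ false) → shape χ n ≡ shape χ m
  shape-stable {n = zero} z≤n _ = refl
  shape-stable {n = suc n} m≤1+n bound with m≤n⇒m<n∨m≡n m≤1+n
  ... | inj₂ refl = refl
  ... | inj₁ (s≤s m≤n) rewrite bound n m≤n = shape-stable m≤n bound

  shape-beadSet : ∀ {ps} → Linked _≥_ ps → ∀ {n} → beadBound ps ≤ n → shape (beadSet ps) n ≡ ps
  shape-beadSet {[]} _ b≤n = shape-stable b≤n (λ _ _ → refl)
  shape-beadSet {p ∷ ps} ls b≤n = trans (shape-stable b≤n (beadSet-bound ls)) top
    where
    x = p + length ps
    agree : ∀ y → y < x → beadSet (p ∷ ps) y ≡ beadSet ps y
    agree y y<x rewrite ≢⇒≡ᵇ-false (<⇒≢ y<x) = refl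
    shape≡ : shape (beadSet ps) x ≡ ps
    shape≡ = shape-beadSet (Linked.tail ls) (beadBound-tail ls)
    rest : shape (beadSet (p ∷ ps)) x ≡ ps
    rest = trans (shape-cong x agree) shape≡
    -- Below the top bead lie the `length ps` beads of the remaining rows, which leaves p gaps.
    first : gaps (beadSet (p ∷ ps)) x ≡ p
    first = +-cancelʳ-≡ (length ps) _ _ (begin
      gaps (beadSet (p ∷ ps)) x + length ps              ≡⟨ cong₂ _+_ (gaps-cong x agree) (cong length (sym shape≡)) ⟩
      gaps (beadSet ps) x + length (shape (beadSet ps) x) ≡⟨ cong (gaps (beadSet ps) x +_) (length-shape _ x) ⟩
      gaps (beadSet ps) x + beads (beadSet ps) x          ≡⟨ gaps+beads _ x ⟩
      x ∎)
      where open ≡-Reasoning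
    top : shape (beadSet (p ∷ ps)) (suc x) ≡ p ∷ ps
    top rewrite ≡ᵇ-refl x = cong₂ _∷_ first rest

  record Encodes (χ : ℕ → Bool) (n : ℕ) (μ : Partition) : Set where
    field
      zero-gap : χ 0 ≡ false
      bounded  : ∀ x → n ≤ x → χ x ≡ false
      size≡    : size μ ≡ sum (shape χ n)
      closed   : ∀ {t} → 0 < t → IsCore t μ → Closed t χ

  encode : ∀ μ → ∃ λ χ → ∃ λ n → Encodes χ n μ
  encode μ@(mkPartition ps ls pos) = χ , n , record
    { zero-gap = χ0
    ; bounded  = beadSet-bound ls
    ; size≡    = cong sum (sym shape≡)
    ; closed   = λ 0<t core → core⇒closed χ {χ0} n 0<t (beadSet-bound ls) (coreOf core)
    }
    where
    χ = beadSet ps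
    n = beadBound ps
    χ0 = beadSet-0 pos
    shape≡ : shape χ n ≡ ps
    shape≡ = shape-beadSet ls ≤-refl
    coreOf : ∀ {t} → IsCore t μ → IsCore t (toPartition χ χ0 n)
    coreOf core i j rewrite shape≡ = core i j

-- Integer sums, sizes as sums over beads, and the spread inequality

module Sums where

  open import Data.Integer using (ℤ; +_; 0ℤ; 1ℤ; _+_; _*_; _-_; _≤_; +≤+; nonNegative)
  open import Data.Integer.Properties
  open import Data.Integer.Tactic.RingSolver using (solve-∀)
  open import Data.Nat as ℕ using (ℕ; zero; suc; _<ᵇ_; s≤s; z≤n)
  import Data.Nat.Properties as ℕ
  open Beads

  0≤* : ∀ {a b} → 0ℤ ≤ a → 0ℤ ≤ b → 0ℤ ≤ a * b
  0≤* {a} {b} 0≤a 0≤b = subst (_≤ a * b) (*-zeroʳ a) (*-monoˡ-≤-nonNeg a {{nonNegative 0≤a}} 0≤b)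

  0≤+ : ∀ {a b} → 0ℤ ≤ a → 0ℤ ≤ b → 0ℤ ≤ a + b
  0≤+ = +-mono-≤

  0≤pos : ∀ n → 0ℤ ≤ + n
  0≤pos n = +≤+ z≤n

  ≤-from : ∀ {a b} d → b - a ≡ d → 0ℤ ≤ d → a ≤ b
  ≤-from d eq 0≤d = 0≤i-j⇒j≤i (subst (0ℤ ≤_) (sym eq) 0≤d)

  6*-distrib : ∀ a b → + 6 * (a - b * b) ≡ + 6 * a - + 6 * (b * b)
  6*-distrib = solve-∀

  +-cancel : ∀ a b → a + b - b ≡ a
  +-cancel = solve-∀

  Σ : ℕ → (ℕ → ℤ) → ℤ
  Σ zero    f = 0ℤ
  Σ (suc n) f = Σ n f + f n

  Σ-cong : ∀ n {f g} → (∀ i → i ℕ.< n → f i ≡ g i) → Σ n f ≡ Σ n g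
  Σ-cong zero    eq = refl
  Σ-cong (suc n) eq = cong₂ _+_ (Σ-cong n λ i i<n → eq i (ℕ.m<n⇒m<1+n i<n)) (eq n ℕ.≤-refl)

  Σ-mono : ∀ n {f g} → (∀ i → i ℕ.< n → f i ≤ g i) → Σ n f ≤ Σ n g
  Σ-mono zero    le = ≤-refl
  Σ-mono (suc n) le = +-mono-≤ (Σ-mono n λ i i<n → le i (ℕ.m<n⇒m<1+n i<n)) (le n ℕ.≤-refl)

  Σ-zero : ∀ n → Σ n (λ _ → 0ℤ) ≡ 0ℤ
  Σ-zero zero    = refl
  Σ-zero (suc n) = trans (+-identityʳ _) (Σ-zero n)

  Σ-nonNeg : ∀ n {f} → (∀ i → i ℕ.< n → 0ℤ ≤ f i) → 0ℤ ≤ Σ n f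
  Σ-nonNeg n le = subst (_≤ Σ n _) (Σ-zero n) (Σ-mono n le)

  Σ-+ : ∀ n f g → Σ n (λ i → f i + g i) ≡ Σ n f + Σ n g
  Σ-+ zero    f g = refl
  Σ-+ (suc n) f g = trans (cong (_+ (f n + g n)) (Σ-+ n f g)) (lemma (Σ n f) (Σ n g) (f n) (g n))
    where
    lemma : ∀ a b c d → (a + b) + (c + d) ≡ (a + c) + (b + d)
    lemma = solve-∀

  Σ-* : ∀ n c f → Σ n (λ i → c * f i) ≡ c * Σ n f
  Σ-* zero    c f = sym (*-zeroʳ c)
  Σ-* (suc n) c f = trans (cong (_+ c * f n) (Σ-* n c f)) (sym (*-distribˡ-+ c (Σ n f) (f n)))

  Σ-split : ∀ m n f → Σ (m ℕ.+ n) f ≡ Σ m f + Σ n (λ i → f (m ℕ.+ i))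
  Σ-split m zero    f rewrite ℕ.+-identityʳ m = sym (+-identityʳ _)
  Σ-split m (suc n) f rewrite ℕ.+-suc m n =
    trans (cong (_+ f (m ℕ.+ n)) (Σ-split m n f)) (+-assoc (Σ m f) _ _)

  Σ-blocks : ∀ M s f → Σ (M ℕ.* s) f ≡ Σ M (λ q → Σ s (λ r → f (r ℕ.+ q ℕ.* s)))
  Σ-blocks zero    s f = refl
  Σ-blocks (suc M) s f = begin
    Σ (s ℕ.+ M ℕ.* s) f                           ≡⟨ cong (λ n → Σ n f) (ℕ.+-comm s (M ℕ.* s)) ⟩
    Σ (M ℕ.* s ℕ.+ s) f                           ≡⟨ Σ-split (M ℕ.* s) s f ⟩
    Σ (M ℕ.* s) f + Σ s (λ r → f (M ℕ.* s ℕ.+ r)) ≡⟨ cong₂ _+_ (Σ-blocks M s f) (Σ-cong s λ r _ → cong f (ℕ.+-comm (M ℕ.* s) r)) ⟩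
    Σ (suc M) (λ q → Σ s (λ r → f (r ℕ.+ q ℕ.* s))) ∎
    where open ≡-Reasoning

  Σ-swap : ∀ m n (f : ℕ → ℕ → ℤ) → Σ m (λ i → Σ n (f i)) ≡ Σ n (λ j → Σ m (λ i → f i j))
  Σ-swap zero    n f = sym (Σ-zero n)
  Σ-swap (suc m) n f = trans (cong (_+ Σ n (f m)) (Σ-swap m n f)) (sym (Σ-+ n _ (f m)))

  𝟙 : Bool → ℤ
  𝟙 true  = 1ℤ
  𝟙 false = 0ℤ

  <ᵇ-true : ∀ {m n} → m ℕ.< n → (m <ᵇ n) ≡ true
  <ᵇ-true {zero}  {suc n} _         = refl
  <ᵇ-true {suc m} {suc n} (s≤s m<n) = <ᵇ-true m<n

  <ᵇ-false : ∀ {m n} → n ℕ.≤ m → (m <ᵇ n) ≡ false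
  <ᵇ-false {m}     {zero}  _         = refl
  <ᵇ-false {suc m} {suc n} (s≤s n≤m) = <ᵇ-false n≤m

  Σ-vanish : ∀ {m n f} → m ℕ.≤ n → (∀ i → m ℕ.≤ i → i ℕ.< n → f i ≡ 0ℤ) → Σ n f ≡ Σ m f
  Σ-vanish {n = zero} z≤n eq = refl
  Σ-vanish {n = suc n} {f} m≤1+n eq with ℕ.m≤n⇒m<n∨m≡n m≤1+n
  ... | inj₂ refl = refl
  ... | inj₁ (s≤s m≤n) = trans (cong (λ z → Σ n f + z) (eq n m≤n ℕ.≤-refl))
    (trans (+-identityʳ _) (Σ-vanish m≤n λ i m≤i i<n → eq i m≤i (ℕ.m<n⇒m<1+n i<n)))

  Σ-below : ∀ {m n} f → m ℕ.≤ n → Σ n (λ i → 𝟙 (i <ᵇ m) * f i) ≡ Σ m f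
  Σ-below {m} {n} f m≤n = trans
    (Σ-vanish m≤n λ i m≤i _ → trans (cong (λ b → 𝟙 b * f i) (<ᵇ-false m≤i)) (*-zeroˡ (f i)))
    (Σ-cong m λ i i<m → trans (cong (λ b → 𝟙 b * f i) (<ᵇ-true i<m)) (*-identityˡ (f i)))

  beads-Σ : ∀ χ n → + beads χ n ≡ Σ n (𝟙 ∘ χ)
  beads-Σ χ zero = refl
  beads-Σ χ (suc n) with χ n
  ... | true  = trans (+-comm 1ℤ (+ beads χ n)) (cong (_+ 1ℤ) (beads-Σ χ n))
  ... | false = trans (beads-Σ χ n) (sym (+-identityʳ _))

  gaps+Σ : ∀ χ n → + gaps χ n + Σ n (𝟙 ∘ χ) ≡ + n
  gaps+Σ χ n = trans (cong (λ z → + gaps χ n + z) (sym (beads-Σ χ n))) (cong +_ (gaps+beads χ n))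

  -- With C beads below it, a bead at n adds a row of n - C boxes, and 2(n - C) = (2n + 1) - ((C +
  -- 1)² - C²); the squares telescope.
  size-Σ : ∀ χ n → + 2 * + sum (shape χ n) ≡
           Σ n (λ x → 𝟙 (χ x) * (+ 2 * + x + 1ℤ)) - Σ n (𝟙 ∘ χ) * Σ n (𝟙 ∘ χ)
  size-Σ χ zero = refl
  size-Σ χ (suc n) with χ n
  ... | false = trans (size-Σ χ n) (lemma (Σ n _) (Σ n (𝟙 ∘ χ)) (+ 2 * + n + 1ℤ))
    where
    lemma : ∀ z c x → z - c * c ≡ z + 0ℤ * x - (c + 0ℤ) * (c + 0ℤ)
    lemma = solve-∀
  ... | true = begin
    + 2 * (+ gaps χ n + + S)                      ≡⟨ *-distribˡ-+ (+ 2) (+ gaps χ n) (+ S) ⟩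
    + 2 * + gaps χ n + + 2 * + S                  ≡⟨ cong (λ z → + 2 * + gaps χ n + z) (size-Σ χ n) ⟩
    + 2 * + gaps χ n + (Z - C * C)                ≡⟨ lemma (+ gaps χ n) C Z ⟩
    Z + 1ℤ * (+ 2 * (+ gaps χ n + C) + 1ℤ) - (C + 1ℤ) * (C + 1ℤ)
      ≡⟨ cong (λ m → Z + 1ℤ * (+ 2 * m + 1ℤ) - (C + 1ℤ) * (C + 1ℤ)) (gaps+Σ χ n) ⟩
    Z + 1ℤ * (+ 2 * + n + 1ℤ) - (C + 1ℤ) * (C + 1ℤ) ∎
    where
    open ≡-Reasoning
    S = sum (shape χ n)
    C = Σ n (𝟙 ∘ χ)
    Z = Σ n (λ x → 𝟙 (χ x) * (+ 2 * + x + 1ℤ))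
    lemma : ∀ g c z → + 2 * g + (z - c * c) ≡ z + 1ℤ * (+ 2 * (g + c) + 1ℤ) - (c + 1ℤ) * (c + 1ℤ)
    lemma = solve-∀

  -- The sum of 2x + 1 over the n smallest x ≡ r modulo s (0 ≤ r < s).
  runner : ℤ → ℤ → ℤ → ℤ
  runner s r n = + 2 * r * n + s * (n * n) - s * n + n

  Σ-runner : ∀ s r n → Σ n (λ q → + 2 * + (r ℕ.+ q ℕ.* s) + 1ℤ) ≡ runner (+ s) (+ r) (+ n)
  Σ-runner s r zero = lemma (+ s) (+ r)
    where
    lemma : ∀ s r → 0ℤ ≡ + 2 * r * 0ℤ + s * 0ℤ - s * 0ℤ + 0ℤ
    lemma = solve-∀
  Σ-runner s r (suc n) = begin
    Σ n _ + (+ 2 * (+ r + + (n ℕ.* s)) + 1ℤ) ≡⟨ cong₂ (λ a b → a + (+ 2 * (+ r + b) + 1ℤ)) (Σ-runner s r n) (pos-* n s) ⟩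
    runner (+ s) (+ r) (+ n) + (+ 2 * (+ r + + n * + s) + 1ℤ) ≡⟨ lemma (+ s) (+ r) (+ n) ⟩
    runner (+ s) (+ r) (1ℤ + + n) ∎
    where
    open ≡-Reasoning
    lemma : ∀ s r n → (+ 2 * r * n + s * (n * n) - s * n + n) + (+ 2 * (r + n * s) + 1ℤ) ≡
            + 2 * r * (1ℤ + n) + s * ((1ℤ + n) * (1ℤ + n)) - s * (1ℤ + n) + (1ℤ + n)
    lemma = solve-∀

  -- The abacus picture of an s-core: on each of the s runners the beads are pushed down to the
  -- lowest positions, so a height per runner describes the whole set.
  record Heights (s : ℕ) (χ : ℕ → Bool) (n : ℕ → ℕ) : Set where
    constructor mkHeights
    field
      at : ∀ r q → r ℕ.< s → χ (r ℕ.+ q ℕ.* s) ≡ (q <ᵇ n r)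
  open Heights public

  -- `size-Σ` read runner by runner. The bound by `M` ensures that a window of `M` rows contains
  -- every bead.
  size-heights : ∀ s χ n M → Heights s χ n → (∀ r → r ℕ.< s → n r ℕ.≤ M) →
                 + 2 * + sum (shape χ (M ℕ.* s)) ≡
                 Σ s (λ r → runner (+ s) (+ r) (+ n r)) - Σ s (λ r → + n r) * Σ s (λ r → + n r)
  size-heights s χ n M heights n≤M =
    trans (size-Σ χ (M ℕ.* s)) (cong₂ (λ a b → a - b * b) weighted counted)
    where
    open ≡-Reasoning
    byRunners : ∀ f → Σ (M ℕ.* s) (λ x → 𝟙 (χ x) * f x) ≡ Σ s (λ r → Σ (n r) (λ q → f (r ℕ.+ q ℕ.* s)))
    byRunners f = begin
      Σ (M ℕ.* s) (λ x → 𝟙 (χ x) * f x)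
        ≡⟨ Σ-blocks M s _ ⟩
      Σ M (λ q → Σ s (λ r → 𝟙 (χ (r ℕ.+ q ℕ.* s)) * f (r ℕ.+ q ℕ.* s)))
        ≡⟨ Σ-swap M s _ ⟩
      Σ s (λ r → Σ M (λ q → 𝟙 (χ (r ℕ.+ q ℕ.* s)) * f (r ℕ.+ q ℕ.* s)))
        ≡⟨ Σ-cong s (λ r r<s → trans
             (Σ-cong M λ q _ → cong (λ b → 𝟙 b * f (r ℕ.+ q ℕ.* s)) (at heights r q r<s))
             (Σ-below (λ q → f (r ℕ.+ q ℕ.* s)) (n≤M r r<s))) ⟩
      Σ s (λ r → Σ (n r) (λ q → f (r ℕ.+ q ℕ.* s))) ∎
    weighted : Σ (M ℕ.* s) (λ x → 𝟙 (χ x) * (+ 2 * + x + 1ℤ)) ≡ Σ s (λ r → runner (+ s) (+ r) (+ n r))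
    weighted = trans (byRunners _) (Σ-cong s λ r _ → Σ-runner s r (n r))
    Σ-one : ∀ n → Σ n (λ _ → 1ℤ) ≡ + n
    Σ-one zero    = refl
    Σ-one (suc n) = trans (cong (_+ 1ℤ) (Σ-one n)) (+-comm (+ n) 1ℤ)
    counted : Σ (M ℕ.* s) (𝟙 ∘ χ) ≡ Σ s (λ r → + n r)
    counted = trans (Σ-cong (M ℕ.* s) λ x _ → sym (*-identityʳ (𝟙 (χ x))))
      (trans (byRunners (λ _ → 1ℤ)) (Σ-cong s λ r _ → Σ-one (n r)))

  1+h*2≡1+h+h : ∀ h → suc (h ℕ.* 2) ≡ suc h ℕ.+ h
  1+h*2≡1+h+h = ℕSolver.solve-∀

  pos-double : ∀ i → + (i ℕ.* 2) ≡ + 2 * + i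
  pos-double i = trans (pos-* i 2) (*-comm (+ i) (+ 2))

  quadratic : ℤ → ℤ → ℤ → ℤ → ℤ
  quadratic α β γ i = α * (i * i) + β * i + γ

  -- The closed forms for sums of squares, of first powers and of constants, multiplied by 6 to stay
  -- within the integers.
  sixfoldSum : ℤ → ℤ → ℤ → ℤ → ℤ
  sixfoldSum α β γ n = α * (n * (n - 1ℤ) * (+ 2 * n - 1ℤ)) + + 3 * β * (n * (n - 1ℤ)) + + 6 * γ * n

  Σ-quadratic : ∀ n α β γ → + 6 * Σ n (λ i → quadratic α β γ (+ i)) ≡ sixfoldSum α β γ (+ n)
  Σ-quadratic zero α β γ = lemma α β γ
    where
    lemma : ∀ α β γ → 0ℤ ≡
      α * (0ℤ * (0ℤ - 1ℤ) * (+ 2 * 0ℤ - 1ℤ)) + + 3 * β * (0ℤ * (0ℤ - 1ℤ)) + + 6 * γ * 0ℤ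
    lemma = solve-∀
  Σ-quadratic (suc n) α β γ =
    trans (*-distribˡ-+ (+ 6) (Σ n (λ i → quadratic α β γ (+ i))) (quadratic α β γ (+ n)))
    (trans (cong (λ z → z + + 6 * quadratic α β γ (+ n)) (Σ-quadratic n α β γ))
      (lemma (+ n) α β γ))
    where
    lemma : ∀ n α β γ →
      α * (n * (n - 1ℤ) * (+ 2 * n - 1ℤ)) + + 3 * β * (n * (n - 1ℤ)) + + 6 * γ * n
        + + 6 * (α * (n * n) + β * n + γ) ≡
      α * ((1ℤ + n) * (1ℤ + n - 1ℤ) * (+ 2 * (1ℤ + n) - 1ℤ)) + + 3 * β * ((1ℤ + n) * (1ℤ + n - 1ℤ)) + + 6 * γ * (1ℤ + n)
    lemma = solve-∀

  Σ-quadratic₂ : ∀ m n {f g α β γ α′ β′ γ′} →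
    (∀ i → i ℕ.< m → f i ≡ quadratic α β γ (+ i)) →
    (∀ i → i ℕ.< n → g i ≡ quadratic α′ β′ γ′ (+ i)) →
    + 6 * (Σ m f + Σ n g) ≡ sixfoldSum α β γ (+ m) + sixfoldSum α′ β′ γ′ (+ n)
  Σ-quadratic₂ m n {f} {g} {α} {β} {γ} {α′} {β′} {γ′} f≡ g≡ = begin
    + 6 * (Σ m f + Σ n g)
      ≡⟨ *-distribˡ-+ (+ 6) (Σ m f) (Σ n g) ⟩
    + 6 * Σ m f + + 6 * Σ n g
      ≡⟨ cong₂ (λ a b → + 6 * a + + 6 * b) (Σ-cong m f≡) (Σ-cong n g≡) ⟩
    + 6 * Σ m (λ i → quadratic α β γ (+ i)) + + 6 * Σ n (λ i → quadratic α′ β′ γ′ (+ i))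
      ≡⟨ cong₂ _+_ (Σ-quadratic m α β γ) (Σ-quadratic n α′ β′ γ′) ⟩
    sixfoldSum α β γ (+ m) + sixfoldSum α′ β′ γ′ (+ n) ∎
    where open ≡-Reasoning

  -- k²(k² − 1) for k = h + 1.
  quartic : ℤ → ℤ
  quartic h = (h + 1ℤ) * (h + 1ℤ) * h * (h + + 2)

  ascending : ∀ (ν : ℕ → ℤ) s → (∀ p → suc p ℕ.< s → ν p ≤ ν (suc p)) → ∀ p q → p ℕ.≤ q → q ℕ.< s → ν p ≤ ν q
  ascending ν s step zero zero _ _ = ≤-refl
  ascending ν s step p (suc q) p≤1+q 1+q<s with ℕ.m≤n⇒m<n∨m≡n p≤1+q
  ... | inj₂ refl      = ≤-refl
  ... | inj₁ (s≤s p≤q) = ≤-trans (ascending ν s step p q p≤q (ℕ.<⇒≤ 1+q<s)) (step q 1+q<s)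

  -- The difference of the two sides is the sum over p < q of (ν q − ν p)(t − (ν q − ν p)).
  spread-bound : ∀ t (ν : ℕ → ℤ) s →
    (∀ p q → p ℕ.< q → q ℕ.< s → 0ℤ ≤ ν q - ν p × 0ℤ ≤ t - (ν q - ν p)) →
    + s * Σ s (λ p → ν p * ν p) - Σ s ν * Σ s ν ≤
    t * (Σ s (λ p → (+ 2 * + p + 1ℤ) * ν p) - + s * Σ s ν)
  spread-bound t ν zero _ = ≤-reflexive (sym (*-zeroʳ t))
  -- Passing to s + 1 terms adds the pairs with q = s, each a product of two nonnegative factors.
  spread-bound t ν (suc s) pairs = ≤-from (R - L + Σ s pair) eq
    (0≤+ (i≤j⇒0≤j-i (spread-bound t ν s λ p q p<q q<s → pairs p q p<q (ℕ.m<n⇒m<1+n q<s)))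
         (Σ-nonNeg s λ p p<s → let lo , hi = pairs p s p<s ℕ.≤-refl in 0≤* lo hi))
    where
    v = ν s
    A = Σ s ν
    Q = Σ s (λ p → ν p * ν p)
    W = Σ s (λ p → (+ 2 * + p + 1ℤ) * ν p)
    L = + s * Q - A * A
    R = t * (W - + s * A)
    pair : ℕ → ℤ
    pair p = (v - ν p) * (t - (v - ν p))
    Σ-pair : ∀ m → Σ m pair ≡
      + m * (t * v - v * v) - t * Σ m ν + + 2 * v * Σ m ν - Σ m (λ p → ν p * ν p)
    Σ-pair zero = lemma v t
      where
      lemma : ∀ v t → 0ℤ ≡ 0ℤ * (t * v - v * v) - t * 0ℤ + + 2 * v * 0ℤ - 0ℤ
      lemma = solve-∀
    Σ-pair (suc m) = trans (cong (_+ pair m) (Σ-pair m)) (lemma v t (+ m) (Σ m ν) (Σ m (λ p → ν p * ν p)) (ν m))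
      where
      lemma : ∀ v t m a q u →
        m * (t * v - v * v) - t * a + + 2 * v * a - q + (v - u) * (t - (v - u)) ≡
        (1ℤ + m) * (t * v - v * v) - t * (a + u) + + 2 * v * (a + u) - (q + u * u)
      lemma = solve-∀
    eq : t * (W + (+ 2 * + s + 1ℤ) * v - (1ℤ + + s) * (A + v)) - ((1ℤ + + s) * (Q + v * v) - (A + v) * (A + v)) ≡
         R - L + Σ s pair
    eq = trans (lemma t (+ s) v A Q W) (cong (λ z → R - L + z) (sym (Σ-pair s)))
      where
      lemma : ∀ t s v a q w →
        t * (w + (+ 2 * s + 1ℤ) * v - (1ℤ + s) * (a + v)) - ((1ℤ + s) * (q + v * v) - (a + v) * (a + v)) ≡
        t * (w - s * a) - (s * q - a * a) + (s * (t * v - v * v) - t * a + + 2 * v * a - q)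
      lemma = solve-∀

-- Runners of the abacus and the two extremal bead sets

module Abacus where

  open import Data.Nat
  open import Data.Nat.Properties
  open import Data.Nat.DivMod
  open import Data.Nat.Divisibility using (divides-refl)
  open Beads
  open Sums using (Heights; mkHeights; at; <ᵇ-true; <ᵇ-false)

  module _ {f : ℕ → Bool} (down : ∀ q → f q ≡ false → f (suc q) ≡ false) where

    gap-up : ∀ {p q} → p ≤ q → f p ≡ false → f q ≡ false
    gap-up {zero}  {zero}  _ fp = fp
    gap-up {p} {suc q} p≤1+q fp with m≤n⇒m<n∨m≡n p≤1+q
    ... | inj₁ (s≤s p≤q) = down q (gap-up p≤q fp)
    ... | inj₂ refl      = fp

    beads-full : ∀ q → f q ≡ true → beads f q ≡ q
    beads-full zero fq = refl
    beads-full (suc q) fq with f q in eq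
    ... | true  = cong suc (beads-full q eq)
    ... | false = ⊥-elim (bead≢gap {f} fq (down q eq))

    beads-stop : ∀ {q} → f q ≡ false → ∀ m → beads f m ≤ q
    beads-stop fq zero = z≤n
    beads-stop {q} fq (suc m) with f m in fm
    ... | false = beads-stop fq m
    ... | true  = ≤-trans (s≤s (beads≤ f m)) (≰⇒> λ q≤m → bead≢gap {f} fm (gap-up q≤m fq))

    -- Beads never sit above a gap here, so they fill an initial segment; the gap at `M` guarantees
    -- that counting below `M` misses none of them.
    down-closed : ∀ {M} → f M ≡ false → ∀ q → f q ≡ (q <ᵇ beads f M)
    down-closed {M} fM q with f q in fq
    ... | false = sym (<ᵇ-false (beads-stop fq M))
    ... | true  = sym (<ᵇ-true (≤-trans
      (≤-reflexive (sym (trans (beads-bead f fq) (cong suc (beads-full q fq)))))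
      (beads-mono f (≰⇒> λ M≤q → bead≢gap {f} fq (gap-up M≤q fM)))))

  heightsOf : ℕ → (ℕ → Bool) → ℕ → ℕ → ℕ
  heightsOf s χ M r = beads (λ q → χ (r + q * s)) M

  heightsOf-correct : ∀ {s χ} M → Closed s χ → (∀ x → M * s ≤ x → χ x ≡ false) →
                      Heights s χ (heightsOf s χ M)
  heightsOf-correct {s} {χ} M closed bound = mkHeights λ r q _ → down-closed
    (λ q χq → subst (λ x → χ x ≡ false) (lemma r q s) (closed (r + q * s) χq))
    {M} (bound _ (m≤n+m _ r)) q
    where
    lemma : ∀ r q s → r + q * s + s ≡ r + suc q * s
    lemma = ℕSolver.solve-∀

  fromHeights : ∀ s .{{_ : NonZero s}} → (ℕ → ℕ) → ℕ → Bool
  fromHeights s n x = x / s <ᵇ n (x % s)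

  fromHeights-correct : ∀ s .{{_ : NonZero s}} n → Heights s (fromHeights s n) n
  fromHeights-correct s n = mkHeights λ r q r<s →
    cong₂ (λ a b → a <ᵇ n b) (quotient r q r<s) (remainder r q r<s)
    where
    remainder : ∀ r q → r < s → (r + q * s) % s ≡ r
    remainder r q r<s = trans ([m+kn]%n≡m%n r q s) (m<n⇒m%n≡m r<s)
    quotient : ∀ r q → r < s → (r + q * s) / s ≡ q
    quotient r q r<s = trans (+-distrib-/-∣ʳ r (divides-refl q)) (cong₂ _+_ (m<n⇒m/n≡0 r<s) (m*n/n≡m q s))

  module _ {s χ n} (heights : Heights s χ n) where

    gap⇒height≤ : ∀ {x} r q → r < s → x ≡ r + q * s → χ x ≡ false → n r ≤ q
    gap⇒height≤ r q r<s refl χx = ≮⇒≥ λ q<n → bead≢gap {χ} (trans (at heights r q r<s) (<ᵇ-true q<n)) χx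

    height≤⇒gap : ∀ {x} r q → r < s → x ≡ r + q * s → n r ≤ q → χ x ≡ false
    height≤⇒gap r q r<s refl n≤q = trans (at heights r q r<s) (<ᵇ-false n≤q)

    -- Every gap is r + q s with q at least the height of runner r, so closure under a shift becomes
    -- a comparison of heights in these coordinates.
    closed-heights : ∀ {t} .{{_ : NonZero s}} →
      (∀ r q → r < s → n r ≤ q → χ (r + q * s + t) ≡ false) → Closed t χ
    closed-heights {t} step y χy = subst (λ x → χ (x + t) ≡ false) (sym y≡)
      (step (y % s) (y / s) (m%n<n y s) (gap⇒height≤ (y % s) (y / s) (m%n<n y s) y≡ χy))
      where
      y≡ : y ≡ y % s + (y / s) * s
      y≡ = m≡m%n+[m/n]*n y s

    closed-period : .{{_ : NonZero s}} → Closed s χ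
    closed-period = closed-heights λ r q r<s n≤q →
      height≤⇒gap r (suc q) r<s (lemma r q s) (m≤n⇒m≤1+n n≤q)
      where
      lemma : ∀ r q s → r + q * s + s ≡ r + suc q * s
      lemma = ℕSolver.solve-∀

  -- For residues r ≤ 2h, this is the row of the smallest semigroup element on runner r: on runner
  -- 2i that element is i (2h + 3), in row i, and on runner 2i + 1 it is (h + 1 + i)(2h + 3), in row
  -- 2 + h + i.
  topHeight : ℕ → ℕ → ℕ
  topHeight h zero          = 0
  topHeight h (suc zero)    = 2 + h
  topHeight h (suc (suc r)) = suc (topHeight h r)

  topHeight-even : ∀ h i → topHeight h (i * 2) ≡ i
  topHeight-even h zero    = refl
  topHeight-even h (suc i) = cong suc (topHeight-even h i)

  topHeight-odd : ∀ h i → topHeight h (1 + i * 2) ≡ 2 + h + i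
  topHeight-odd h zero    = cong (λ n → 2 + n) (sym (+-identityʳ h))
  topHeight-odd h (suc i) = trans (cong suc (topHeight-odd h i)) (sym (+-suc (2 + h) i))

  topHeight-bound : ∀ h r → topHeight h r ≤ 2 + h + r
  topHeight-bound h zero          = z≤n
  topHeight-bound h (suc zero)    = m≤m+n (2 + h) 1
  topHeight-bound h (suc (suc r)) = ≤-trans (s≤s (topHeight-bound h r)) (≤-trans (n≤1+n _)
    (≤-reflexive (lemma h r)))
    where
    lemma : ∀ h r → 2 + (2 + h + r) ≡ 2 + h + (2 + r)
    lemma = ℕSolver.solve-∀

  -- Bead set: all the gaps of the numerical semigroup generated by 2h + 1 and 2h + 3.
  topSet : ℕ → ℕ → Bool
  topSet h = fromHeights (suc (h * 2)) (topHeight h)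

  topSet-heights : ∀ h → Heights (suc (h * 2)) (topSet h) (topHeight h)
  topSet-heights h = fromHeights-correct (suc (h * 2)) (topHeight h)

  -- Adding 2h + 3 moves two runners to the right and one row up. Only the last two runners wrap
  -- around, to runners 0 and 1 when h > 0, at the price of a second row.
  topSet-closed : ∀ h → Closed (3 + h * 2) (topSet h)
  topSet-closed h = closed-heights (topSet-heights h) step
    where
    s = suc (h * 2)
    to = height≤⇒gap (topSet-heights h)
    shift : ∀ r q a → r + q * suc a + (3 + a) ≡ (2 + r) + suc q * suc a
    shift = ℕSolver.solve-∀
    wrap₀ : ∀ r q → r + q * suc (1 + r) + (3 + (1 + r)) ≡ 0 + (2 + q) * suc (1 + r)
    wrap₀ = ℕSolver.solve-∀
    wrap₁ : ∀ q a → a + q * suc a + (3 + a) ≡ 1 + (2 + q) * suc a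
    wrap₁ = ℕSolver.solve-∀
    step : ∀ r q → r < s → topHeight h r ≤ q → topSet h (r + q * s + (3 + h * 2)) ≡ false
    step r q r<s le with m≤n⇒m<n∨m≡n r<s
    step r q r<s le | inj₂ refl = last h refl
      where
      last : ∀ h′ → h′ ≡ h → topSet h (h * 2 + q * s + (3 + h * 2)) ≡ false
      -- For h = 0 there is a single runner, and the shift by 3 stays on it.
      last zero refl    = to 0 (3 + q) (s≤s z≤n) (wrap₁′ q) z≤n
        where
        wrap₁′ : ∀ q → q * 1 + 3 ≡ 0 + (3 + q) * 1
        wrap₁′ = ℕSolver.solve-∀
      last (suc h′) refl = to 1 (2 + q) (s≤s (s≤s z≤n)) (wrap₁ q (h * 2))
        (s≤s (s≤s (subst (_≤ q) (topHeight-even h h) le)))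
    step r q r<s le | inj₁ (s≤s r<2h) with m≤n⇒m<n∨m≡n r<2h
    ... | inj₁ 1+r<2h = to (2 + r) (suc q) (s≤s 1+r<2h) (shift r q (h * 2)) (s≤s le)
    ... | inj₂ 1+r≡2h = to 0 (2 + q) (s≤s z≤n) (lemma (h * 2) 1+r≡2h) z≤n
      where
      lemma : ∀ a → suc r ≡ a → r + q * suc a + (3 + a) ≡ 0 + (2 + q) * suc a
      lemma _ refl = wrap₀ r q

  module _ {h χ n} (heights : Heights (suc (h * 2)) χ n) (closed : Closed (3 + h * 2) χ) where

    private
      s = suc (h * 2)
      next : ∀ r → r < s → χ (r + n r * s + (3 + h * 2)) ≡ false
      next r r<s = closed _ (height≤⇒gap heights r (n r) r<s refl ≤-refl)

    -- The lowest gap of runner `r`, shifted by 2h + 3, is a gap one row higher on runner `2 + r`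
    -- and caps the height there.
    height-step : ∀ r → 2 + r < s → n (2 + r) ≤ suc (n r)
    height-step r r+2<s = gap⇒height≤ heights (2 + r) (suc (n r)) r+2<s (shift r (n r) (h * 2))
      (next r (≤-trans (n≤1+n _) (≤-trans (n≤1+n _) r+2<s)))
      where
      shift : ∀ r q a → r + q * suc a + (3 + a) ≡ (2 + r) + suc q * suc a
      shift = ℕSolver.solve-∀

    -- The same shift from the last runner 2h wraps around to runner 1 and gains two rows.
    height-wrap : 1 < s → n 1 ≤ 2 + n (h * 2)
    height-wrap 1<s = gap⇒height≤ heights 1 (2 + n (h * 2)) 1<s (wrap (n (h * 2)) (h * 2)) (next (h * 2) ≤-refl)
      where
      wrap : ∀ q a → a + q * suc a + (3 + a) ≡ 1 + (2 + q) * suc a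
      wrap = ℕSolver.solve-∀

  -- Sums of j generators fill the interval from j (2h + 2) - j to j (2h + 2) + j. So, in rows of
  -- length 2h + 2, place r of row q belongs to the semigroup exactly when r ≤ q or 2h + 1 - r ≤ q.
  tentHeight : ℕ → ℕ → ℕ
  tentHeight h r = r ⊓ (suc (h * 2) ∸ r)

  -- Bead set: all the gaps of the numerical semigroup generated by 2h + 1, 2h + 2 and 2h + 3.
  tentSet : ℕ → ℕ → Bool
  tentSet h = fromHeights (2 + h * 2) (tentHeight h)

  tentSet-heights : ∀ h → Heights (2 + h * 2) (tentSet h) (tentHeight h)
  tentSet-heights h = fromHeights-correct (2 + h * 2) (tentHeight h)

  -- The two outer periods move one runner to the left or to the right, where the tent changes by at
  -- most one; wrapping at either end lands on a runner of height 0.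
  tentSet-closed : ∀ h → Closed (1 + h * 2) (tentSet h) × Closed (2 + h * 2) (tentSet h) × Closed (3 + h * 2) (tentSet h)
  tentSet-closed h = closed-heights H back , closed-period H , closed-heights H forth
    where
    H = tentSet-heights h
    w = suc (h * 2)
    to = height≤⇒gap H
    up : ∀ r → tentHeight h (suc r) ≤ suc (tentHeight h r)
    up r = ⊓-mono-≤ {suc r} {suc r} {w ∸ suc r} {suc (w ∸ r)} ≤-refl (≤-trans (∸-monoʳ-≤ w (n≤1+n r)) (n≤1+n _))
    down : ∀ r → r < w → tentHeight h r ≤ suc (tentHeight h (suc r))
    down r r<w = ⊓-mono-≤ {r} {2 + r} {w ∸ r} {suc (w ∸ suc r)} (≤-trans (n≤1+n r) (n≤1+n _)) (≤-reflexive (+-∸-assoc 1 r<w))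
    back : ∀ r q → r < suc w → tentHeight h r ≤ q → tentSet h (r + q * suc w + w) ≡ false
    back zero q _ _ = to w q ≤-refl (lemma q w) (≤-trans (m⊓n≤n w _) (≤-trans (≤-reflexive (n∸n≡0 w)) z≤n))
      where
      lemma : ∀ q w → q * suc w + w ≡ w + q * suc w
      lemma = ℕSolver.solve-∀
    back (suc r) q (s≤s r<w) le = to r (suc q) (m<n⇒m<1+n r<w) (lemma r q w) (≤-trans (down r r<w) (s≤s le))
      where
      lemma : ∀ r q w → suc r + q * suc w + w ≡ r + suc q * suc w
      lemma = ℕSolver.solve-∀
    forth : ∀ r q → r < suc w → tentHeight h r ≤ q → tentSet h (r + q * suc w + (2 + w)) ≡ false
    forth r q r<1+w le with m≤n⇒m<n∨m≡n r<1+w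
    ... | inj₁ 1+r<1+w = to (suc r) (suc q) 1+r<1+w (lemma r q w) (≤-trans (up r) (s≤s le))
      where
      lemma : ∀ r q w → r + q * suc w + (2 + w) ≡ suc r + suc q * suc w
      lemma = ℕSolver.solve-∀
    ... | inj₂ refl = to 0 (2 + q) (s≤s z≤n) (lemma q r) z≤n
      where
      lemma : ∀ q w → w + q * suc w + (2 + w) ≡ 0 + (2 + q) * suc w
      lemma = ℕSolver.solve-∀

-- Largest (2h + 1, 2h + 3)-cores

module TwoCores where

  open import Data.Integer using (ℤ; +_; 0ℤ; 1ℤ; _+_; _*_; _-_; -_; _≤_; +≤+)
  open import Data.Integer.Properties
  open import Data.Integer.Tactic.RingSolver using (solve-∀)
  open import Data.Nat as ℕ using (ℕ; zero; suc; _<ᵇ_; s≤s; z≤n)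
  import Data.Nat.Properties as ℕ
  open Beads
  open Sums
  open Abacus

  Σ-parity : ∀ h f → Σ (suc (h ℕ.* 2)) f ≡ Σ (suc h) (λ i → f (i ℕ.* 2)) + Σ h (λ i → f (1 ℕ.+ i ℕ.* 2))
  Σ-parity zero f = sym (+-identityʳ _)
  Σ-parity (suc h) f =
    trans (cong (λ z → z + f (suc (h ℕ.* 2)) + f (suc h ℕ.* 2)) (Σ-parity h f))
          (lemma (Σ (suc h) (λ i → f (i ℕ.* 2))) _ _ _)
    where
    lemma : ∀ a b c d → a + b + c + d ≡ a + d + (b + c)
    lemma = solve-∀

  -- The residue of p (2h + 3) modulo 2h + 1, for p ≤ 2h: first the even residues, then the odd ones.
  residue : ℕ → ℕ → ℕ
  residue h p = if p <ᵇ suc h then p ℕ.* 2 else 1 ℕ.+ (p ℕ.∸ suc h) ℕ.* 2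

  residue-even : ∀ h {p} → p ℕ.≤ h → residue h p ≡ p ℕ.* 2
  residue-even h p≤h rewrite <ᵇ-true (s≤s p≤h) = refl

  residue-odd : ∀ h i → residue h (suc h ℕ.+ i) ≡ 1 ℕ.+ i ℕ.* 2
  residue-odd h i rewrite <ᵇ-false (ℕ.m≤m+n (suc h) i) = cong (λ j → 1 ℕ.+ j ℕ.* 2) (ℕ.m+n∸m≡n h i)

  data Half (h : ℕ) : ℕ → Set where
    evenHalf : ∀ {p} → p ℕ.≤ h → Half h p
    oddHalf  : ∀ i → i ℕ.< h → Half h (suc h ℕ.+ i)

  half : ∀ h p → p ℕ.< suc (h ℕ.* 2) → Half h p
  half h p p<s with ℕ.≤-<-connex p h
  ... | inj₁ p≤h = evenHalf p≤h
  ... | inj₂ h<p with ℕ.m≤n⇒∃[o]m+o≡n h<p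
  ...   | i , refl = oddHalf i (ℕ.+-cancelˡ-< (suc h) _ _ (subst (suc h ℕ.+ i ℕ.<_) (1+h*2≡1+h+h h) p<s))

  -- Since 2h + 3 is 2 modulo the odd number 2h + 1, its multiples visit every residue once:
  -- splitting by parity exhibits the permutation.
  Σ-residue : ∀ h f → Σ (suc (h ℕ.* 2)) f ≡ Σ (suc (h ℕ.* 2)) (f ∘ residue h)
  Σ-residue h f = begin
    Σ (suc (h ℕ.* 2)) f
      ≡⟨ Σ-parity h f ⟩
    Σ (suc h) (λ i → f (i ℕ.* 2)) + Σ h (λ i → f (1 ℕ.+ i ℕ.* 2))
      ≡⟨ cong₂ _+_ (Σ-cong (suc h) λ { i (s≤s i≤h) → cong f (residue-even h i≤h) })
                   (Σ-cong h λ i _ → cong f (residue-odd h i)) ⟨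
    Σ (suc h) (f ∘ residue h) + Σ h (λ i → f (residue h (suc h ℕ.+ i)))
      ≡⟨ Σ-split (suc h) h (f ∘ residue h) ⟨
    Σ (suc h ℕ.+ h) (f ∘ residue h)
      ≡⟨ cong (λ n → Σ n (f ∘ residue h)) (1+h*2≡1+h+h h) ⟨
    Σ (suc (h ℕ.* 2)) (f ∘ residue h) ∎
    where open ≡-Reasoning

  module _ (h : ℕ) where

    private
      H = + h
      s = suc (h ℕ.* 2)
      S = 1ℤ + + 2 * H
      T = + 3 + + 2 * H
      S≡ : + s ≡ S
      S≡ = cong (λ z → 1ℤ + z) (pos-double h)

    -- The smallest semigroup element on the p-th runner is p T itself (the Apéry set), and
    -- subtracting its row number times S leaves the residue. This makes residues linear in p and
    -- the height.
    topHeight-residue : ∀ p → p ℕ.< s →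
      + residue h p ≡ + p * T - S * + topHeight h (residue h p)
    topHeight-residue p p<s with half h p p<s
    ... | evenHalf p≤h rewrite residue-even h p≤h | topHeight-even h p =
      trans (pos-double p) (lemma H (+ p))
      where
      lemma : ∀ h p → + 2 * p ≡ p * (+ 3 + + 2 * h) - (1ℤ + + 2 * h) * p
      lemma = solve-∀
    ... | oddHalf i _ rewrite residue-odd h i | topHeight-odd h i =
      trans (cong (λ z → 1ℤ + z) (pos-double i)) (lemma H (+ i))
      where
      lemma : ∀ h i → 1ℤ + + 2 * i ≡
        (1ℤ + h + i) * (+ 3 + + 2 * h) - (1ℤ + + 2 * h) * (+ 2 + h + i)
      lemma = solve-∀

    -- This is the classical count (S - 1)(T - 1)/2 of the gaps of a semigroup with two coprime
    -- generators.
    topHeight-sum : Σ s (λ r → + topHeight h r) ≡ + 2 * H * (H + 1ℤ)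
    topHeight-sum = *-cancelˡ-≡ (+ 6) _ _ (trans (cong (λ z → + 6 * z) (Σ-parity h _)) (trans
      (Σ-quadratic₂ (suc h) h {α = 0ℤ} {1ℤ} {0ℤ} {0ℤ} {1ℤ} {+ 2 + H}
        (λ i _ → trans (cong +_ (topHeight-even h i)) (lemma₁ (+ i)))
        (λ i _ → trans (cong +_ (topHeight-odd h i)) (lemma₂ H (+ i))))
      (lemma₃ H)))
      where
      lemma₁ : ∀ i → i ≡ 0ℤ * (i * i) + 1ℤ * i + 0ℤ
      lemma₁ = solve-∀
      lemma₂ : ∀ h i → + 2 + h + i ≡ 0ℤ * (i * i) + 1ℤ * i + (+ 2 + h)
      lemma₂ = solve-∀
      lemma₃ : ∀ h →
        0ℤ * ((1ℤ + h) * (1ℤ + h - 1ℤ) * (+ 2 * (1ℤ + h) - 1ℤ)) + + 3 * 1ℤ * ((1ℤ + h) * (1ℤ + h - 1ℤ)) + + 6 * 0ℤ * (1ℤ + h)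
        + (0ℤ * (h * (h - 1ℤ) * (+ 2 * h - 1ℤ)) + + 3 * 1ℤ * (h * (h - 1ℤ)) + + 6 * (+ 2 + h) * h)
        ≡ + 6 * (+ 2 * h * (h + 1ℤ))
      lemma₃ = solve-∀

    topRunner-sum : + 6 * Σ s (λ r → runner S (+ r) (+ topHeight h r)) ≡
      + 8 * quartic H + + 6 * ((+ 2 * H * (H + 1ℤ)) * (+ 2 * H * (H + 1ℤ)))
    topRunner-sum = trans (cong (λ z → + 6 * z) (Σ-parity h _)) (trans
      -- The coefficients come from expanding `runner` on runner 2i at height i and on runner 1 + 2i
      -- at height 2 + h + i.
      (Σ-quadratic₂ (suc h) h {α = + 5 + + 2 * H} { - (+ 2 * H)} {0ℤ}
          {+ 5 + + 2 * H} {+ 4 * H * H + + 12 * H + + 14} {(+ 2 + H) * (+ 4 + + 3 * H + + 2 * H * H)}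
        (λ i _ → trans (cong₂ (runner S) (pos-double i) (cong +_ (topHeight-even h i))) (lemma₁ H (+ i)))
        (λ i _ → trans (cong₂ (runner S) (cong (λ z → 1ℤ + z) (pos-double i)) (cong +_ (topHeight-odd h i))) (lemma₂ H (+ i))))
      (lemma₃ H))
      where
      lemma₁ : ∀ h i → + 2 * (+ 2 * i) * i + (1ℤ + + 2 * h) * (i * i) - (1ℤ + + 2 * h) * i + i ≡
        (+ 5 + + 2 * h) * (i * i) + - (+ 2 * h) * i + 0ℤ
      lemma₁ = solve-∀
      lemma₂ : ∀ h i →
        + 2 * (1ℤ + + 2 * i) * (+ 2 + h + i) + (1ℤ + + 2 * h) * ((+ 2 + h + i) * (+ 2 + h + i))
          - (1ℤ + + 2 * h) * (+ 2 + h + i) + (+ 2 + h + i) ≡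
        (+ 5 + + 2 * h) * (i * i) + (+ 4 * h * h + + 12 * h + + 14) * i + (+ 2 + h) * (+ 4 + + 3 * h + + 2 * h * h)
      lemma₂ = solve-∀
      lemma₃ : ∀ h →
        (+ 5 + + 2 * h) * ((1ℤ + h) * (1ℤ + h - 1ℤ) * (+ 2 * (1ℤ + h) - 1ℤ))
          + + 3 * (- (+ 2 * h)) * ((1ℤ + h) * (1ℤ + h - 1ℤ)) + + 6 * 0ℤ * (1ℤ + h)
        + ((+ 5 + + 2 * h) * (h * (h - 1ℤ) * (+ 2 * h - 1ℤ))
          + + 3 * (+ 4 * h * h + + 12 * h + + 14) * (h * (h - 1ℤ))
          + + 6 * ((+ 2 + h) * (+ 4 + + 3 * h + + 2 * h * h)) * h)
        ≡ + 8 * ((h + 1ℤ) * (h + 1ℤ) * h * (h + + 2)) + + 6 * ((+ 2 * h * (h + 1ℤ)) * (+ 2 * h * (h + 1ℤ)))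
      lemma₃ = solve-∀

    -- The value is the known maximum (S² - 1)(T² - 1)/24, multiplied by 12.
    topTotal : + 6 * (Σ s (λ r → runner S (+ r) (+ topHeight h r)) -
                      Σ s (λ r → + topHeight h r) * Σ s (λ r → + topHeight h r)) ≡
               + 8 * quartic H
    topTotal = trans (6*-distrib (Σ s _) (Σ s (λ r → + topHeight h r))) (trans
      (cong₂ (λ a b → a - + 6 * (b * b)) topRunner-sum topHeight-sum)
      (+-cancel (+ 8 * quartic H) _))

    sixfold-size : ∀ {χ n M} → Heights s χ n → (∀ r → r ℕ.< s → n r ℕ.≤ M) →
      + 12 * + sum (shape χ (M ℕ.* s)) ≡
      + 6 * (Σ s (λ r → runner S (+ r) (+ n r)) - Σ s (λ r → + n r) * Σ s (λ r → + n r))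
    sixfold-size {χ} {n} {M} heights n≤M = trans (*-assoc (+ 6) (+ 2) (+ sum (shape χ (M ℕ.* s))))
      (cong (λ z → + 6 * z) (trans (size-heights s χ n M heights n≤M)
        (cong (λ w → Σ s (λ r → runner w (+ r) (+ n r)) - Σ s (λ r → + n r) * Σ s (λ r → + n r)) S≡)))

    topSet-size : + 12 * + sum (shape (topSet h) ((2 ℕ.+ h ℕ.+ s) ℕ.* s)) ≡
                  + 8 * quartic H
    topSet-size = trans (sixfold-size (topSet-heights h) λ r r<s →
      ℕ.≤-trans (topHeight-bound h r) (ℕ.+-monoʳ-≤ (2 ℕ.+ h) (ℕ.<⇒≤ r<s))) topTotal

    module _ {χ : ℕ → Bool} {n : ℕ → ℕ} (heights : Heights s χ n)
             (closed : Closed (3 ℕ.+ h ℕ.* 2) χ) (n0 : n 0 ≡ 0) where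

      -- The sequence ν of the overview, listed in the order of the multiples of T.
      deficit : ℕ → ℤ
      deficit p = + topHeight h (residue h p) - + n (residue h p)

      deficit-0 : deficit 0 ≡ 0ℤ
      deficit-0 rewrite n0 = refl

      -- From one multiple of T to the next, `topHeight` rises by exactly the amount that closure
      -- allows the heights `n` to rise at most.
      deficit-step : ∀ p → suc p ℕ.< s → deficit p ≤ deficit (suc p)
      deficit-step p 1+p<s = step p (half h (suc p) 1+p<s)
        where
        shift : ∀ {a b c} d → b ℕ.≤ d ℕ.+ c → + a - + c ≤ + (d ℕ.+ a) - + b
        shift {a} {b} {c} d le = ≤-from (+ (d ℕ.+ c) - + b) (lemma (+ a) (+ b) (+ c) (+ d)) (i≤j⇒0≤j-i (+≤+ le))
          where
          lemma : ∀ a b c d → d + a - b - (a - c) ≡ d + c - b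
          lemma = solve-∀
        step : ∀ p → Half h (suc p) → deficit p ≤ deficit (suc p)
        step p (evenHalf 1+p≤h)
          rewrite residue-even h 1+p≤h | residue-even h (ℕ.<⇒≤ 1+p≤h) =
          shift 1 (height-step {h} heights closed (p ℕ.* 2) (s≤s (ℕ.*-monoˡ-≤ 2 1+p≤h)))
        -- The only wrap, from residue 2h to residue 1: `topHeight` rises from h to h + 2.
        step p (oddHalf zero 0<h)
          rewrite ℕ.+-identityʳ h | residue-even h (ℕ.≤-refl {h})
                | trans (cong (residue h) (sym (ℕ.+-identityʳ (suc h)))) (residue-odd h 0)
                | topHeight-even h h =
          shift 2 (height-wrap {h} heights closed (s≤s (ℕ.≤-trans 0<h (ℕ.m≤m*n h 2))))
        step p (oddHalf (suc i) i<h)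
          rewrite ℕ.+-suc h i | residue-odd h i
                | trans (cong (residue h) (sym (ℕ.+-suc (suc h) i))) (residue-odd h (suc i)) =
          shift 1 (height-step {h} heights closed (1 ℕ.+ i ℕ.* 2) (s≤s (ℕ.<⇒≤ (ℕ.*-monoˡ-≤ 2 i<h))))

      deficit-mono : ∀ p q → p ℕ.≤ q → q ℕ.< s → deficit p ≤ deficit q
      deficit-mono = ascending deficit s deficit-step

      deficit-nonNeg : ∀ p → p ℕ.< s → 0ℤ ≤ deficit p
      deficit-nonNeg p p<s = subst (_≤ deficit p) deficit-0 (deficit-mono 0 p z≤n p<s)

      deficit-bound : ∀ p → p ℕ.< s → deficit p ≤ T
      deficit-bound p p<s = ≤-trans (i-j≤i (+ topHeight h (residue h p)) (+ n (residue h p)))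
        (subst (+ topHeight h (residue h p) ≤_) (cong (λ z → + 3 + z) (pos-double h)) (+≤+ (top (half h p p<s))))
        where
        h≤2h : h ℕ.≤ h ℕ.* 2
        h≤2h = ℕ.m≤m*n h 2
        top : ∀ {p} → Half h p → topHeight h (residue h p) ℕ.≤ 3 ℕ.+ h ℕ.* 2
        top {p} (evenHalf p≤h) rewrite residue-even h p≤h | topHeight-even h p =
          ℕ.≤-trans p≤h (ℕ.≤-trans h≤2h (ℕ.m≤n+m _ 3))
        top (oddHalf i i<h) rewrite residue-odd h i | topHeight-odd h i =
          s≤s (s≤s (ℕ.≤-trans (ℕ.+-monoʳ-≤ h (ℕ.<⇒≤ i<h)) (ℕ.≤-trans
            (ℕ.≤-reflexive (trans (cong (h ℕ.+_) (sym (ℕ.+-identityʳ h))) (ℕ.*-comm 2 h))) (ℕ.n≤1+n _))))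

      -- Expanding around `topHeight`, the difference is the slack of `spread-bound` plus a multiple
      -- of V. The coefficient of V is (S - 1)(T - 1) - 2 G, and it vanishes by the gap count
      -- `topHeight-sum`.
      heights-total : Σ s (λ r → runner S (+ r) (+ n r)) - Σ s (λ r → + n r) * Σ s (λ r → + n r) ≤
        Σ s (λ r → runner S (+ r) (+ topHeight h r)) - Σ s (λ r → + topHeight h r) * Σ s (λ r → + topHeight h r)
      heights-total = subst₂ _≤_ (sym lhs) (sym rhs)
        (≤-from _ (trans (expand R Q W V G S T) (cong (λ z → T * (W - S * V) - (S * Q - V * V) + z * V) central))
          (subst (0ℤ ≤_) (sym (drop _ V)) (i≤j⇒0≤j-i spread)))
        where
        a : ℕ → ℤ
        a p = + topHeight h (residue h p)
        d = deficit
        R = Σ s (λ p → runner S (+ residue h p) (a p))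
        G = Σ s a
        Q = Σ s (λ p → d p * d p)
        W = Σ s (λ p → (+ 2 * + p + 1ℤ) * d p)
        V = Σ s d
        spread : S * Q - V * V ≤ T * (W - S * V)
        spread = subst (λ z → z * Q - V * V ≤ T * (W - z * V)) S≡ (spread-bound T d s λ p q p<q q<s →
          i≤j⇒0≤j-i (deficit-mono p q (ℕ.<⇒≤ p<q) q<s) ,
          subst (0ℤ ≤_) (regroup T (d q) (d p))
            (0≤+ (i≤j⇒0≤j-i (deficit-bound q q<s)) (deficit-nonNeg p (ℕ.<-trans p<q q<s))))
          where
          regroup : ∀ t x y → t - x + y ≡ t - (x - y)
          regroup = solve-∀
        -- Replacing the residue by p T - S a turns the linear term of `runner` into the weight 2p +
        -- 1 that `spread-bound` expects.
        pointwise : ∀ p → p ℕ.< s → runner S (+ residue h p) (+ n (residue h p)) ≡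
          runner S (+ residue h p) (a p) + (S * (d p * d p) + (- T * ((+ 2 * + p + 1ℤ) * d p) + (S - 1ℤ + T) * d p))
        pointwise p p<s = subst (λ z → runner S z (+ n (residue h p)) ≡ runner S z (a p) +
            (S * (d p * d p) + (- T * ((+ 2 * + p + 1ℤ) * d p) + (S - 1ℤ + T) * d p)))
          (sym (topHeight-residue p p<s)) (lemma S T (a p) (+ n (residue h p)) (+ p))
          where
          lemma : ∀ s t a n p →
            + 2 * (p * t - s * a) * n + s * (n * n) - s * n + n ≡
            + 2 * (p * t - s * a) * a + s * (a * a) - s * a + a
              + (s * ((a - n) * (a - n)) + (- t * ((+ 2 * p + 1ℤ) * (a - n)) + (s - 1ℤ + t) * (a - n)))
          lemma = solve-∀
        runners : Σ s (λ r → runner S (+ r) (+ n r)) ≡ R + (S * Q + (- T * W + (S - 1ℤ + T) * V))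
        runners = begin
          Σ s (λ r → runner S (+ r) (+ n r))
            ≡⟨ Σ-residue h _ ⟩
          Σ s (λ p → runner S (+ residue h p) (+ n (residue h p)))
            ≡⟨ Σ-cong s pointwise ⟩
          Σ s (λ p → runner S (+ residue h p) (a p) + (S * (d p * d p) + (- T * ((+ 2 * + p + 1ℤ) * d p) + (S - 1ℤ + T) * d p)))
            ≡⟨ trans (Σ-+ s _ _) (cong (λ z → R + z) (trans (Σ-+ s _ _) (cong₂ _+_ (Σ-* s S _)
                 (trans (Σ-+ s _ _) (cong₂ _+_ (Σ-* s (- T) _) (Σ-* s (S - 1ℤ + T) d)))))) ⟩
          R + (S * Q + (- T * W + (S - 1ℤ + T) * V)) ∎
          where open ≡-Reasoning
        counts : Σ s (λ r → + n r) ≡ G - V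
        counts = trans (Σ-residue h _) (trans
          (Σ-cong s λ p _ → lemma (a p) (+ n (residue h p)))
          (trans (Σ-+ s a _) (trans (cong (λ z → G + z) (Σ-* s (- 1ℤ) d)) (sym (lemma′ G V)))))
          where
          lemma : ∀ a n → n ≡ a + (- 1ℤ) * (a - n)
          lemma = solve-∀
          lemma′ : ∀ a n → a - n ≡ a + (- 1ℤ) * n
          lemma′ = solve-∀
        lhs : Σ s (λ r → runner S (+ r) (+ n r)) - Σ s (λ r → + n r) * Σ s (λ r → + n r) ≡
              R + (S * Q + (- T * W + (S - 1ℤ + T) * V)) - (G - V) * (G - V)
        lhs = cong₂ (λ x y → x - y * y) runners counts
        rhs : Σ s (λ r → runner S (+ r) (+ topHeight h r)) - Σ s (λ r → + topHeight h r) * Σ s (λ r → + topHeight h r) ≡ R - G * G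
        rhs = cong₂ (λ x y → x - y * y) (Σ-residue h _) (Σ-residue h _)
        expand : ∀ r q w v g s t →
          r - g * g - (r + (s * q + (- t * w + (s - 1ℤ + t) * v)) - (g - v) * (g - v)) ≡
          t * (w - s * v) - (s * q - v * v) + ((s - 1ℤ) * (t - 1ℤ) - + 2 * g) * v
        expand = solve-∀
        central : (S - 1ℤ) * (T - 1ℤ) - + 2 * G ≡ 0ℤ
        central = trans (cong (λ g → (S - 1ℤ) * (T - 1ℤ) - + 2 * g) (trans (sym (Σ-residue h _)) topHeight-sum)) (lemma H)
          where
          lemma : ∀ h → (1ℤ + + 2 * h - 1ℤ) * (+ 3 + + 2 * h - 1ℤ) - + 2 * (+ 2 * h * (h + 1ℤ)) ≡ 0ℤ
          lemma = solve-∀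
        drop : ∀ x v → x + 0ℤ * v ≡ x
        drop = solve-∀

    twoCore-bound : ∀ {χ m} → χ 0 ≡ false → (∀ x → m ℕ.≤ x → χ x ≡ false) →
      Closed s χ → Closed (3 ℕ.+ h ℕ.* 2) χ →
      + 12 * + sum (shape χ m) ≤ + 8 * quartic H
    twoCore-bound {χ} {m} χ0 bound closed-s closed-t = subst₂ _≤_ (sym size≡) topTotal
      -- The gap at 0 empties runner 0, so the deficit starts at 0.
      (*-monoˡ-≤-nonNeg (+ 6) (heights-total heights closed-t (ℕ.n≤0⇒n≡0 (gap⇒height≤ heights 0 0 (s≤s z≤n) refl χ0))))
      where
      m≤ms : m ℕ.≤ m ℕ.* s
      m≤ms = ℕ.m≤m*n m s
      n = heightsOf s χ m
      heights : Heights s χ n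
      heights = heightsOf-correct m closed-s (λ x ms≤x → bound x (ℕ.≤-trans m≤ms ms≤x))
      size≡ : + 12 * + sum (shape χ m) ≡
        + 6 * (Σ s (λ r → runner S (+ r) (+ n r)) - Σ s (λ r → + n r) * Σ s (λ r → + n r))
      size≡ = trans (cong (λ ps → + 12 * + sum ps) (sym (shape-stable m≤ms bound)))
        (sixfold-size heights (λ r _ → beads≤ _ m))

-- Largest (2h + 1, 2h + 2, 2h + 3)-cores

module ThreeCores where

  open import Data.Integer using (ℤ; +_; -[1+_]; 0ℤ; 1ℤ; _+_; _*_; _-_; -_; _≤_; +≤+)
  open import Data.Integer.Properties
  open import Data.Integer.Tactic.RingSolver using (solve-∀)
  open import Data.Nat as ℕ using (ℕ; zero; suc; _<ᵇ_; s≤s; z≤n)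
  import Data.Nat.Properties as ℕ
  open Beads
  open Sums
  open Abacus

  module _ (h : ℕ) where

    private
      H = + h
      w = 2 ℕ.+ h ℕ.* 2
      L = + 2 + + 2 * H
      w≡ : + w ≡ L
      w≡ = cong (λ z → + 2 + z) (pos-double h)
      Σ-halves : ∀ f → Σ w f ≡ Σ (suc h) f + Σ (suc h) (λ i → f (suc h ℕ.+ i))
      Σ-halves f = trans (cong (λ n → Σ n f) (lemma h)) (Σ-split (suc h) (suc h) f)
        where
        lemma : ∀ h → 2 ℕ.+ h ℕ.* 2 ≡ suc h ℕ.+ suc h
        lemma = ℕSolver.solve-∀

    tentHeight-low : ∀ i → i ℕ.< suc h → + tentHeight h i ≡ + i
    tentHeight-low i (s≤s i≤h) = cong +_ (ℕ.m≤n⇒m⊓n≡m (ℕ.m+n≤o⇒m≤o∸n i (ℕ.≤-trans (ℕ.+-mono-≤ i≤h i≤h)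
      (ℕ.≤-trans (ℕ.n≤1+n _) (ℕ.≤-reflexive (sym (1+h*2≡1+h+h h)))))))

    tentHeight-high : ∀ i → i ℕ.< suc h → + tentHeight h (suc h ℕ.+ i) ≡ H - + i
    tentHeight-high i (s≤s i≤h) = begin
      + ((suc h ℕ.+ i) ℕ.⊓ (suc (h ℕ.* 2) ℕ.∸ (suc h ℕ.+ i)))
        ≡⟨ cong (λ z → + ((suc h ℕ.+ i) ℕ.⊓ z)) (trans (cong (ℕ._∸ (suc h ℕ.+ i)) (1+h*2≡1+h+h h))
             (ℕ.[m+n]∸[m+o]≡n∸o (suc h) h i)) ⟩
      + ((suc h ℕ.+ i) ℕ.⊓ (h ℕ.∸ i))
        ≡⟨ cong +_ (ℕ.m≥n⇒m⊓n≡n (ℕ.≤-trans (ℕ.m∸n≤m h i) (ℕ.≤-trans (ℕ.n≤1+n h) (ℕ.m≤m+n (suc h) i)))) ⟩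
      + (h ℕ.∸ i)
        ≡⟨ trans (sym (⊖-≥ i≤h)) (sym (m-n≡m⊖n h i)) ⟩
      H - + i ∎
      where open ≡-Reasoning

    tentHeight-sum : Σ w (λ r → + tentHeight h r) ≡ H * (H + 1ℤ)
    tentHeight-sum = *-cancelˡ-≡ (+ 6) _ _ (trans (cong (λ z → + 6 * z) (Σ-halves _)) (trans
      (Σ-quadratic₂ (suc h) (suc h) {α = 0ℤ} {1ℤ} {0ℤ} {0ℤ} { - 1ℤ} {H}
        (λ i i<n → trans (tentHeight-low i i<n) (lemma₁ (+ i)))
        (λ i i<n → trans (tentHeight-high i i<n) (lemma₂ H (+ i))))
      (lemma₃ H)))
      where
      lemma₁ : ∀ i → i ≡ 0ℤ * (i * i) + 1ℤ * i + 0ℤ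
      lemma₁ = solve-∀
      lemma₂ : ∀ h i → h - i ≡ 0ℤ * (i * i) + (- 1ℤ) * i + h
      lemma₂ = solve-∀
      lemma₃ : ∀ h →
        0ℤ * ((1ℤ + h) * (1ℤ + h - 1ℤ) * (+ 2 * (1ℤ + h) - 1ℤ)) + + 3 * 1ℤ * ((1ℤ + h) * (1ℤ + h - 1ℤ)) + + 6 * 0ℤ * (1ℤ + h)
        + (0ℤ * ((1ℤ + h) * (1ℤ + h - 1ℤ) * (+ 2 * (1ℤ + h) - 1ℤ)) + + 3 * (- 1ℤ) * ((1ℤ + h) * (1ℤ + h - 1ℤ)) + + 6 * h * (1ℤ + h))
        ≡ + 6 * (h * (h + 1ℤ))
      lemma₃ = solve-∀

    tentRunner-sum : + 6 * Σ w (λ r → runner L (+ r) (+ tentHeight h r)) ≡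
      + 2 * quartic H + + 6 * ((H * (H + 1ℤ)) * (H * (H + 1ℤ)))
    tentRunner-sum = trans (cong (λ z → + 6 * z) (Σ-halves _)) (trans
      -- The coefficients come from expanding `runner` on the rising half, runner i at height i, and
      -- on the falling half, runner h + 1 + i at height h - i.
      (Σ-quadratic₂ (suc h) (suc h) {α = + 4 + + 2 * H} { - (1ℤ + + 2 * H)} {0ℤ}
          {+ 2 * H} { - (+ 4 * H * H + + 2 * H + 1ℤ)} {+ 2 * H * H * H + + 2 * H * H + H}
        (λ i i<n → trans (cong (runner L (+ i)) (tentHeight-low i i<n)) (lemma₁ H (+ i)))
        (λ i i<n → trans (cong (runner L (+ (suc h ℕ.+ i))) (tentHeight-high i i<n)) (lemma₂ H (+ i))))
      (lemma₃ H))
      where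
      lemma₁ : ∀ h i → + 2 * i * i + (+ 2 + + 2 * h) * (i * i) - (+ 2 + + 2 * h) * i + i ≡
        (+ 4 + + 2 * h) * (i * i) + - (1ℤ + + 2 * h) * i + 0ℤ
      lemma₁ = solve-∀
      lemma₂ : ∀ h i →
        + 2 * (1ℤ + h + i) * (h - i) + (+ 2 + + 2 * h) * ((h - i) * (h - i)) - (+ 2 + + 2 * h) * (h - i) + (h - i) ≡
        + 2 * h * (i * i) + - (+ 4 * h * h + + 2 * h + 1ℤ) * i + (+ 2 * h * h * h + + 2 * h * h + h)
      lemma₂ = solve-∀
      lemma₃ : ∀ h →
        (+ 4 + + 2 * h) * ((1ℤ + h) * (1ℤ + h - 1ℤ) * (+ 2 * (1ℤ + h) - 1ℤ))
          + + 3 * (- (1ℤ + + 2 * h)) * ((1ℤ + h) * (1ℤ + h - 1ℤ)) + + 6 * 0ℤ * (1ℤ + h)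
        + (+ 2 * h * ((1ℤ + h) * (1ℤ + h - 1ℤ) * (+ 2 * (1ℤ + h) - 1ℤ))
          + + 3 * (- (+ 4 * h * h + + 2 * h + 1ℤ)) * ((1ℤ + h) * (1ℤ + h - 1ℤ))
          + + 6 * (+ 2 * h * h * h + + 2 * h * h + h) * (1ℤ + h))
        ≡ + 2 * ((h + 1ℤ) * (h + 1ℤ) * h * (h + + 2)) + + 6 * ((h * (h + 1ℤ)) * (h * (h + 1ℤ)))
      lemma₃ = solve-∀

    tentSet-size : + 12 * + sum (shape (tentSet h) (w ℕ.* w)) ≡ + 2 * quartic H
    tentSet-size = begin
      + 12 * + N
        ≡⟨ *-assoc (+ 6) (+ 2) (+ N) ⟩
      + 6 * (+ 2 * + N)
        ≡⟨ cong (λ z → + 6 * z) (size-heights w (tentSet h) (tentHeight h) w (tentSet-heights h)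
             (λ r r<w → ℕ.≤-trans (ℕ.m⊓n≤m r _) (ℕ.<⇒≤ r<w))) ⟩
      + 6 * (Σ w (λ r → runner (+ w) (+ r) (+ tentHeight h r)) - C * C)
        ≡⟨ cong (λ z → + 6 * (Σ w (λ r → runner z (+ r) (+ tentHeight h r)) - C * C)) w≡ ⟩
      + 6 * (Σ w (λ r → runner L (+ r) (+ tentHeight h r)) - C * C)
        ≡⟨ 6*-distrib (Σ w _) C ⟩
      + 6 * Σ w (λ r → runner L (+ r) (+ tentHeight h r)) - + 6 * (C * C)
        ≡⟨ cong₂ (λ a b → a - + 6 * (b * b)) tentRunner-sum tentHeight-sum ⟩
      K + + 6 * ((H * (H + 1ℤ)) * (H * (H + 1ℤ))) - + 6 * ((H * (H + 1ℤ)) * (H * (H + 1ℤ)))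
        ≡⟨ +-cancel K _ ⟩
      K ∎
      where
      open ≡-Reasoning
      N = sum (shape (tentSet h) (w ℕ.* w))
      C = Σ w (λ r → + tentHeight h r)
      K = + 2 * quartic H

  -- A bead of g at i forces beads of f at i - 1, i and i + 1. The lowest bead of g thus accounts
  -- for three beads of f, and each later one adds the bead to its right.
  beads-widen : ∀ {f g} → (∀ i → f i ≡ false → g i ≡ false) →
    (∀ i → f i ≡ false → g (suc i) ≡ false) → (∀ i → f (suc i) ≡ false → g i ≡ false) →
    g 0 ≡ false → ∀ m → 0 ℕ.< beads g m → 2 ℕ.+ beads g m ℕ.≤ beads f (suc m)
  beads-widen {f} {g} same right left g0 (suc m) pos with g m in gm
  ... | false = ℕ.≤-trans (beads-widen same right left g0 m pos) (beads-mono f (ℕ.n≤1+n _))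
  ... | true with beads g m in count
  ...   | suc c = subst₂ (λ a b → 3 ℕ.+ a ℕ.≤ b) count
            (sym (beads-bead f (gap-contrapositive (left m) gm)))
            (s≤s (beads-widen same right left g0 m (subst (0 ℕ.<_) (sym count) (s≤s z≤n))))
  -- The lowest bead of g; as `g 0` is a gap, it has a left neighbour.
  ...   | zero = three m gm
    where
    three : ∀ m → g m ≡ true → 3 ℕ.≤ beads f (2 ℕ.+ m)
    three zero    gm = ⊥-elim (bead≢gap {g} gm g0)
    three (suc m) gm
      rewrite gap-contrapositive (left (suc m)) gm
            | gap-contrapositive (same (suc m)) gm
            | gap-contrapositive (right m) gm = s≤s (s≤s (s≤s z≤n))

  -- Equality holds when the beads fill the top of the interval.
  weight-bound : ∀ f m → Σ m (λ i → 𝟙 (f i) * (+ 2 * + i + 1ℤ)) ≤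
                         Σ m (𝟙 ∘ f) * (+ 2 * + m - Σ m (𝟙 ∘ f))
  weight-bound f zero = ≤-refl
  weight-bound f (suc m) with f m
  ... | true  = ≤-from (C * (+ 2 * + m - C) - Z) (lemma (+ m) Z C) (i≤j⇒0≤j-i (weight-bound f m))
    where
    C = Σ m (𝟙 ∘ f)
    Z = Σ m (λ i → 𝟙 (f i) * (+ 2 * + i + 1ℤ))
    lemma : ∀ m z c → (c + 1ℤ) * (+ 2 * (1ℤ + m) - (c + 1ℤ)) - (z + 1ℤ * (+ 2 * m + 1ℤ)) ≡ c * (+ 2 * m - c) - z
    lemma = solve-∀
  ... | false = ≤-from (C * (+ 2 * + m - C) - Z + + 2 * C) (lemma (+ m) Z C)
    (0≤+ (i≤j⇒0≤j-i (weight-bound f m)) (0≤* (0≤pos 2) (subst (0ℤ ≤_) (beads-Σ f m) (0≤pos _))))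
    where
    C = Σ m (𝟙 ∘ f)
    Z = Σ m (λ i → 𝟙 (f i) * (+ 2 * + i + 1ℤ))
    lemma : ∀ m z c → (c + 0ℤ) * (+ 2 * (1ℤ + m) - (c + 0ℤ)) - (z + 0ℤ * (+ 2 * m + 1ℤ)) ≡ c * (+ 2 * m - c) - z + + 2 * c
    lemma = solve-∀

  n²+n≥0 : ∀ n → 0ℤ ≤ n * n + n
  n²+n≥0 (+ n)     = 0≤+ (0≤* (0≤pos n) (0≤pos n)) (0≤pos n)
  n²+n≥0 -[1+ n ] = subst (0ℤ ≤_) (lemma (+ n)) (0≤* (0≤pos (suc n)) (0≤pos n))
    where
    lemma : ∀ n → (1ℤ + n) * n ≡ (- (1ℤ + n)) * (- (1ℤ + n)) + - (1ℤ + n)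
    lemma = solve-∀

  -- Here J = k − 1 − e, and the slack in the last step is polynomial in e with nonnegative coefficients.
  rows-bound : ∀ e J (r : ℕ → ℕ) → let k = 1ℤ + + J + + e in
    (∀ j → suc j ℕ.< J → 2 ℕ.+ r (suc j) ℕ.≤ r j) → (∀ j → + r j ≤ + 2 * k) →
    + 6 * (Σ J (λ j → + r j * ((+ 4 * k - + 2) * (+ j + 1ℤ) - + r j)) - Σ J (λ j → + r j) * Σ J (λ j → + r j)) ≤
    + 2 * (k * k * (k - 1ℤ) * (k + 1ℤ))
  rows-bound e J r gap width = ≤-trans (*-monoˡ-≤-nonNeg (+ 6) total)
    (≤-from (+ 2 * k * (E * E * E + + 3 * (+ J + 1ℤ) * (E * E) + E * (+ 3 * + J + + 2)))
      (trans (cong (λ z → + 2 * (k * k * (k - 1ℤ) * (k + 1ℤ)) - z) profile) (lemma (+ J) E))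
      (0≤* (0≤* (0≤pos 2) 0≤k) (0≤+ (0≤+ (0≤* (0≤* 0≤E 0≤E) 0≤E) (0≤* (0≤* (0≤pos 3) (0≤+ (0≤pos J) (0≤pos 1))) (0≤* 0≤E 0≤E)))
        (0≤* 0≤E (0≤+ (0≤* (0≤pos 3) (0≤pos J)) (0≤pos 2))))))
    where
    E = + e
    k = 1ℤ + + J + E
    -- The coefficient of (2j + 1) ν j in `weights`, up to sign; the spread of ν is at most 2k, so
    -- `spread-bound` applies.
    T = + 2 * k + 1ℤ
    0≤E = 0≤pos e
    0≤k : 0ℤ ≤ k
    0≤k = 0≤+ (0≤pos (suc J)) 0≤E
    -- With this constant the progression `peak` has mean k - 1 over its J terms.
    c = + J + k - + 2
    peak : ℕ → ℤ
    peak j = c - + 2 * + j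
    ν : ℕ → ℤ
    ν j = peak j - + r j
    P = Σ J peak
    F = Σ J (λ j → peak j * ((+ 4 * k - + 2) * (+ j + 1ℤ) - peak j))
    Q = Σ J (λ j → ν j * ν j)
    W = Σ J (λ j → (+ 2 * + j + 1ℤ) * ν j)
    V = Σ J ν
    lemma : ∀ j e → + 2 * ((1ℤ + j + e) * (1ℤ + j + e) * (1ℤ + j + e - 1ℤ) * (1ℤ + j + e + 1ℤ)) - + 2 * (j * (j + 1ℤ) * (1ℤ + j + e) * (+ 3 * (1ℤ + j + e) - 1ℤ - + 2 * j))
       ≡ + 2 * (1ℤ + j + e) * (e * e * e + + 3 * (j + 1ℤ) * (e * e) + e * (+ 3 * j + + 2))
    lemma = solve-∀
    P≡ : P ≡ + J * (k - 1ℤ)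
    P≡ = *-cancelˡ-≡ (+ 6) _ _ (trans
      (cong (λ z → + 6 * z) (Σ-cong J λ j _ → lemma₁ c (+ j)))
      (trans (Σ-quadratic J 0ℤ (- + 2) c) (lemma₂ (+ J) E)))
      where
      lemma₁ : ∀ c j → c - + 2 * j ≡ 0ℤ * (j * j) + (- + 2) * j + c
      lemma₁ = solve-∀
      lemma₂ : ∀ j e →
        0ℤ * (j * (j - 1ℤ) * (+ 2 * j - 1ℤ)) + + 3 * (- + 2) * (j * (j - 1ℤ)) + + 6 * (j + (1ℤ + j + e) - + 2) * j ≡
        + 6 * (j * (1ℤ + j + e - 1ℤ))
      lemma₂ = solve-∀
    6F≡ : + 6 * F ≡ sixfoldSum (- (+ 8 * k)) (+ 4 * k * c - + 2 * (+ 4 * k - + 2 - c)) (c * (+ 4 * k - + 2 - c)) (+ J)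
    6F≡ = trans
      (cong (λ z → + 6 * z) (Σ-cong J λ j _ → lemma₁ c k (+ j)))
      (Σ-quadratic J (- (+ 8 * k)) (+ 4 * k * c - + 2 * (+ 4 * k - + 2 - c)) (c * (+ 4 * k - + 2 - c)))
      where
      lemma₁ : ∀ c k j → (c - + 2 * j) * ((+ 4 * k - + 2) * (j + 1ℤ) - (c - + 2 * j)) ≡
        - (+ 8 * k) * (j * j) + (+ 4 * k * c - + 2 * (+ 4 * k - + 2 - c)) * j + c * (+ 4 * k - + 2 - c)
      lemma₁ = solve-∀
    -- The value of the progression with J rows; at J = k - 1 it equals 2k²(k² - 1).
    profile : + 6 * (F - P * P) ≡ + 2 * (+ J * (+ J + 1ℤ) * k * (+ 3 * k - 1ℤ - + 2 * + J))
    profile = trans (6*-distrib F P) (trans (cong₂ (λ a b → a - + 6 * (b * b)) 6F≡ P≡) (lemma₁ (+ J) k))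
      where
      lemma₁ : ∀ j k →
        - (+ 8 * k) * (j * (j - 1ℤ) * (+ 2 * j - 1ℤ))
          + + 3 * (+ 4 * k * (j + k - + 2) - + 2 * (+ 4 * k - + 2 - (j + k - + 2))) * (j * (j - 1ℤ))
          + + 6 * ((j + k - + 2) * (+ 4 * k - + 2 - (j + k - + 2))) * j
          - + 6 * (j * (k - 1ℤ) * (j * (k - 1ℤ))) ≡
        + 2 * (j * (j + 1ℤ) * k * (+ 3 * k - 1ℤ - + 2 * j))
      lemma₁ = solve-∀
    ν-step : ∀ j → suc j ℕ.< J → ν j ≤ ν (suc j)
    ν-step j 1+j<J = ≤-from (+ r j - + (2 ℕ.+ r (suc j))) (lemma₁ c (+ j) (+ r j) (+ r (suc j))) (i≤j⇒0≤j-i (+≤+ (gap j 1+j<J)))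
      where
      lemma₁ : ∀ c j a b → c - + 2 * (1ℤ + j) - b - (c - + 2 * j - a) ≡ a - (+ 2 + b)
      lemma₁ = solve-∀
    ν-spread : ∀ p q → p ℕ.< q → 0ℤ ≤ T - (ν q - ν p)
    ν-spread p q p<q = subst (0ℤ ≤_) (lemma₁ c k (+ p) (+ q) (+ r p) (+ r q))
      (0≤+ (0≤+ (0≤+ (i≤j⇒0≤j-i (width p)) (0≤pos 1)) (0≤pos (r q)))
        (0≤* (0≤pos 2) (i≤j⇒0≤j-i (+≤+ (ℕ.<⇒≤ p<q)))))
      where
      lemma₁ : ∀ c k p q a b → + 2 * k - a + 1ℤ + b + + 2 * (q - p) ≡
        + 2 * k + 1ℤ - (c - + 2 * q - b - (c - + 2 * p - a))
      lemma₁ = solve-∀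
    spread : + J * Q - V * V ≤ T * (W - + J * V)
    spread = spread-bound T ν J λ p q p<q q<J →
      i≤j⇒0≤j-i (ascending ν J ν-step p q (ℕ.<⇒≤ p<q) q<J) , ν-spread p q p<q
    -- Integrality enters here: real r_j could do better by a fraction.
    Q+V≥0 : 0ℤ ≤ Q + V
    Q+V≥0 = subst (0ℤ ≤_) (Σ-+ J (λ j → ν j * ν j) ν) (Σ-nonNeg J λ j _ → n²+n≥0 (ν j))
    weights : Σ J (λ j → + r j * ((+ 4 * k - + 2) * (+ j + 1ℤ) - + r j)) ≡
              F + (- T * W + ((+ 2 * + J - 1ℤ) * V + (- 1ℤ) * Q))
    weights = trans (Σ-cong J λ j _ → lemma₁ (+ J) k (+ j) (+ r j))
      (trans (Σ-+ J _ _) (cong (λ z → F + z) (trans (Σ-+ J _ _) (cong₂ _+_ (Σ-* J (- T) _)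
        (trans (Σ-+ J _ _) (cong₂ _+_ (Σ-* J (+ 2 * + J - 1ℤ) ν) (Σ-* J (- 1ℤ) _)))))))
      where
      lemma₁ : ∀ n k j r → r * ((+ 4 * k - + 2) * (j + 1ℤ) - r) ≡
        (n + k - + 2 - + 2 * j) * ((+ 4 * k - + 2) * (j + 1ℤ) - (n + k - + 2 - + 2 * j))
        + (- (+ 2 * k + 1ℤ) * ((+ 2 * j + 1ℤ) * (n + k - + 2 - + 2 * j - r))
          + ((+ 2 * n - 1ℤ) * (n + k - + 2 - + 2 * j - r)
            + (- 1ℤ) * ((n + k - + 2 - + 2 * j - r) * (n + k - + 2 - + 2 * j - r))))
      lemma₁ = solve-∀
    counts : Σ J (λ j → + r j) ≡ + J * (k - 1ℤ) - V
    counts = trans (Σ-cong J λ j _ → lemma₁ (peak j) (+ r j)) (trans (Σ-+ J peak _)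
      (trans (cong₂ _+_ P≡ (Σ-* J (- 1ℤ) ν)) (sym (lemma₂ (+ J * (k - 1ℤ)) V))))
      where
      lemma₁ : ∀ a r → r ≡ a + (- 1ℤ) * (a - r)
      lemma₁ = solve-∀
      lemma₂ : ∀ a b → a - b ≡ a + (- 1ℤ) * b
      lemma₂ = solve-∀
    -- The difference is the slack of `spread` plus (J + 1)(Q + V).
    total : Σ J (λ j → + r j * ((+ 4 * k - + 2) * (+ j + 1ℤ) - + r j)) - Σ J (λ j → + r j) * Σ J (λ j → + r j) ≤ F - P * P
    total = subst₂ _≤_ (sym (cong₂ (λ a b → a - b * b) weights counts)) (cong (λ z → F - z * z) (sym P≡))
      (≤-from _ (lemma₁ F Q W V (+ J) k)
        (0≤+ (i≤j⇒0≤j-i spread) (0≤* (0≤+ (0≤pos J) (0≤pos 1)) Q+V≥0)))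
      where
      lemma₁ : ∀ f q w v j k →
        f - j * (k - 1ℤ) * (j * (k - 1ℤ))
          - (f + (- (+ 2 * k + 1ℤ) * w + ((+ 2 * j - 1ℤ) * v + (- 1ℤ) * q)) - (j * (k - 1ℤ) - v) * (j * (k - 1ℤ) - v)) ≡
        (+ 2 * k + 1ℤ) * (w - j * v) - (j * q - v * v) + (j + 1ℤ) * (q + v)
      lemma₁ = solve-∀

  -- Rows of a bead set closed under the three shifts

  module _ (h : ℕ) {χ : ℕ → Bool} (χ0 : χ 0 ≡ false)
           (closed₁ : Closed (1 ℕ.+ h ℕ.* 2) χ) (closed₂ : Closed (2 ℕ.+ h ℕ.* 2) χ)
           (closed₃ : Closed (3 ℕ.+ h ℕ.* 2) χ) where

    private
      w = 2 ℕ.+ h ℕ.* 2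
      H = + h
      k = H + 1ℤ
      w≡ : + w ≡ + 2 * k
      w≡ = trans (cong (λ z → + 2 + z) (pos-double h)) (lemma H)
        where
        lemma : ∀ h → + 2 + + 2 * h ≡ + 2 * (h + 1ℤ)
        lemma = solve-∀
      gap-at : ∀ {x y} → x ≡ y → χ x ≡ false → χ y ≡ false
      gap-at refl χx = χx

    row : ℕ → ℕ → Bool
    row j i = χ (i ℕ.+ j ℕ.* w)

    rowCount : ℕ → ℕ
    rowCount j = beads (row j) w

    -- With rows of length 2h + 2, the three periods carry a gap to the next row, displaced by 0, 1
    -- or -1 places.
    row-up : ∀ j i → row j i ≡ false → row (suc j) i ≡ false
    row-up j i gap = gap-at (lemma i j w) (closed₂ _ gap)
      where
      lemma : ∀ i j w → i ℕ.+ j ℕ.* w ℕ.+ w ≡ i ℕ.+ (w ℕ.+ j ℕ.* w)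
      lemma = ℕSolver.solve-∀

    row-right : ∀ j i → row j i ≡ false → row (suc j) (suc i) ≡ false
    row-right j i gap = gap-at (lemma i (j ℕ.* w) w) (closed₃ _ gap)
      where
      lemma : ∀ i j w → i ℕ.+ j ℕ.+ suc w ≡ suc i ℕ.+ (w ℕ.+ j)
      lemma = ℕSolver.solve-∀

    row-left : ∀ j i → row j (suc i) ≡ false → row (suc j) i ≡ false
    row-left j i gap = gap-at (lemma i (j ℕ.* w) (suc (h ℕ.* 2))) (closed₁ _ gap)
      where
      lemma : ∀ i j w → suc i ℕ.+ j ℕ.+ w ≡ i ℕ.+ (suc w ℕ.+ j)
      lemma = ℕSolver.solve-∀

    row-first : ∀ j → row j 0 ≡ false
    row-first zero    = χ0
    row-first (suc j) = row-up j 0 (row-first j)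

    -- From the first place, the shift by 2h + 1 stays in the same row.
    row-last : ∀ j → row j (suc (h ℕ.* 2)) ≡ false
    row-last j = gap-at (ℕ.+-comm (j ℕ.* w) (suc (h ℕ.* 2))) (closed₁ _ (row-first j))

    -- The gap in the last place spreads one place to the left with every row, so beads of row j are
    -- confined to its first w - (j + 1) places.
    row-support : ∀ j i → i ℕ.< w → w ℕ.≤ suc (j ℕ.+ i) → row j i ≡ false
    row-support j i i<w w≤ with ℕ.m≤n⇒m<n∨m≡n i<w
    row-support j       i i<w w≤ | inj₂ refl = row-last j
    row-support zero    i i<w w≤ | inj₁ 1+i<w = contradiction w≤ (ℕ.<⇒≱ 1+i<w)
    row-support (suc j) i i<w w≤ | inj₁ 1+i<w =
      row-left j i (row-support j (suc i) 1+i<w (subst (λ z → w ℕ.≤ suc z) (sym (ℕ.+-suc j i)) w≤))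

    -- As the last place of row j + 1 is a gap, its beads are counted without that place, which
    -- leaves the extra position that `beads-widen` needs in row j.
    rowCount-gap : ∀ j → 0 ℕ.< rowCount (suc j) → 2 ℕ.+ rowCount (suc j) ℕ.≤ rowCount j
    rowCount-gap j pos = subst (λ c → 2 ℕ.+ c ℕ.≤ rowCount j) (sym last) (beads-widen
      (row-up j) (row-right j) (row-left j) (row-first (suc j)) (suc (h ℕ.* 2)) (subst (0 ℕ.<_) last pos))
      where
      last : rowCount (suc j) ≡ beads (row (suc j)) (suc (h ℕ.* 2))
      last = beads-gap (row (suc j)) (row-last (suc j))

    rowCount-first : rowCount 0 ℕ.≤ h ℕ.* 2
    rowCount-first = ℕ.≤-trans (ℕ.≤-reflexive (beads-gap (row 0) (row-last 0)))
      (beads-tail (h ℕ.* 2))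
      where
      beads-tail : ∀ n → beads (row 0) (suc n) ℕ.≤ n
      beads-tail n = ℕ.s≤s⁻¹ (subst (suc (beads (row 0) (suc n)) ℕ.≤_) (gaps+beads (row 0) (suc n))
        (ℕ.+-monoˡ-≤ (beads (row 0) (suc n)) (gaps-strict (row 0) (row-first 0) (s≤s z≤n))))

    rowWeight : ℕ → ℤ
    rowWeight j = Σ w (λ i → 𝟙 (row j i) * (+ 2 * + (i ℕ.+ j ℕ.* w) + 1ℤ))

    -- `weight-bound` is applied to the first m = w - (j + 1) places, the only ones that can carry
    -- beads; the offset j w of the row adds 2 j w per bead.
    rowWeight-bound : ∀ j → j ℕ.≤ h → rowWeight j ≤ + rowCount j * ((+ 4 * k - + 2) * (+ j + 1ℤ) - + rowCount j)
    rowWeight-bound j j≤h with ℕ.m≤n⇒∃[o]m+o≡n (ℕ.≤-trans (s≤s j≤h) (ℕ.≤-trans (s≤s (ℕ.m≤m*n h 2)) (ℕ.n≤1+n _)))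
    ... | m , 1+j+m≡w = subst₂ _≤_ (sym split) bound≡ (+-monoˡ-≤ (+ 2 * (+ j * + w) * C) bounded)
      where
      C = + rowCount j
      Z = Σ w (λ i → 𝟙 (row j i) * (+ 2 * + i + 1ℤ))
      m≤w : m ℕ.≤ w
      m≤w = subst (m ℕ.≤_) 1+j+m≡w (ℕ.m≤n+m m (suc j))
      outside : ∀ i → m ℕ.≤ i → i ℕ.< w → row j i ≡ false
      outside i m≤i i<w = row-support j i i<w (subst (ℕ._≤ suc (j ℕ.+ i)) 1+j+m≡w (s≤s (ℕ.+-monoʳ-≤ j m≤i)))
      Cm≡ : Σ m (𝟙 ∘ row j) ≡ C
      Cm≡ = trans (sym (Σ-vanish m≤w λ i m≤i i<w → cong 𝟙 (outside i m≤i i<w))) (sym (beads-Σ (row j) w))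
      Zm≡ : Z ≡ Σ m (λ i → 𝟙 (row j i) * (+ 2 * + i + 1ℤ))
      Zm≡ = Σ-vanish m≤w λ i m≤i i<w → trans (cong (λ b → 𝟙 b * (+ 2 * + i + 1ℤ)) (outside i m≤i i<w)) (*-zeroˡ (+ 2 * + i + 1ℤ))
      bounded : Z ≤ C * (+ 2 * + m - C)
      bounded = subst₂ (λ z c → z ≤ c * (+ 2 * + m - c)) (sym Zm≡) Cm≡ (weight-bound (row j) m)
      split : rowWeight j ≡ Z + + 2 * (+ j * + w) * C
      split = trans (Σ-cong w λ i _ → trans
          (cong (λ z → 𝟙 (row j i) * (+ 2 * (+ i + z) + 1ℤ)) (pos-* j w))
          (lemma (𝟙 (row j i)) (+ i) (+ j * + w)))
        (trans (Σ-+ w _ _) (cong (λ z → Z + z) (trans (Σ-* w (+ 2 * (+ j * + w)) (𝟙 ∘ row j))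
          (cong (λ z → + 2 * (+ j * + w) * z) (sym (beads-Σ (row j) w))))))
        where
        lemma : ∀ b i a → b * (+ 2 * (i + a) + 1ℤ) ≡ b * (+ 2 * i + 1ℤ) + + 2 * a * b
        lemma = solve-∀
      m≡ : + m ≡ + 2 * k - (1ℤ + + j)
      m≡ = trans (lemma (+ m) (1ℤ + + j)) (cong (λ z → z - (1ℤ + + j)) (trans (cong +_ 1+j+m≡w) w≡))
        where
        lemma : ∀ m j → m ≡ j + m - j
        lemma = solve-∀
      bound≡ : C * (+ 2 * + m - C) + + 2 * (+ j * + w) * C ≡ C * ((+ 4 * k - + 2) * (+ j + 1ℤ) - C)
      bound≡ = trans (cong₂ (λ a b → C * (+ 2 * a - C) + + 2 * (+ j * b) * C) m≡ w≡) (lemma C k (+ j))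
        where
        lemma : ∀ c k j → c * (+ 2 * (+ 2 * k - (1ℤ + j)) - c) + + 2 * (j * (+ 2 * k)) * c ≡
          c * ((+ 4 * k - + 2) * (j + 1ℤ) - c)
        lemma = solve-∀

    threeCore-bound : ∀ {m} → (∀ x → m ℕ.≤ x → χ x ≡ false) →
      + 12 * + sum (shape χ m) ≤ + 2 * quartic H
    threeCore-bound {m} bound = subst (_≤ K) (sym size≡) (≤-trans (*-monoˡ-≤-nonNeg (+ 6) rows≤) final)
      where
      K = + 2 * quartic H
      nonempty : ℕ → Bool
      nonempty j = 0 <ᵇ rowCount j
      empty⇒0 : ∀ n → (0 <ᵇ n) ≡ false → n ≡ 0
      empty⇒0 zero _ = refl
      nonempty⇒0< : ∀ n → (0 <ᵇ n) ≡ true → 0 ℕ.< n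
      nonempty⇒0< (suc n) _ = s≤s z≤n
      down : ∀ j → nonempty j ≡ false → nonempty (suc j) ≡ false
      down j empty with rowCount (suc j) in count
      ... | zero  = refl
      ... | suc c with subst (2 ℕ.+ rowCount (suc j) ℕ.≤_) (empty⇒0 _ empty)
                       (rowCount-gap j (subst (0 ℕ.<_) (sym count) (s≤s z≤n)))
      ...   | ()
      m≤mw : m ℕ.≤ m ℕ.* w
      m≤mw = ℕ.m≤m*n m w
      rowCount-m : rowCount m ≡ 0
      rowCount-m = beads-none (row m) w λ i → bound _ (ℕ.≤-trans m≤mw (ℕ.m≤n+m _ i))
      -- Empty rows stay empty further up, so the nonempty rows are exactly the first J.
      J = beads nonempty m
      below-J : ∀ j → nonempty j ≡ (j <ᵇ J)
      below-J = down-closed down {m} (cong (0 <ᵇ_) rowCount-m)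
      rowCount-pos : ∀ j → j ℕ.< J → 0 ℕ.< rowCount j
      rowCount-pos j j<J = nonempty⇒0< _ (trans (below-J j) (<ᵇ-true j<J))
      rowCount-zero : ∀ j → J ℕ.≤ j → rowCount j ≡ 0
      rowCount-zero j J≤j = empty⇒0 _ (trans (below-J j) (<ᵇ-false J≤j))
      gap : ∀ j → suc j ℕ.< J → 2 ℕ.+ rowCount (suc j) ℕ.≤ rowCount j
      gap j 1+j<J = rowCount-gap j (rowCount-pos (suc j) 1+j<J)
      tower : ∀ j → j ℕ.< J → rowCount j ℕ.+ j ℕ.* 2 ℕ.≤ rowCount 0
      tower zero    _     = ℕ.≤-reflexive (ℕ.+-identityʳ _)
      tower (suc j) 1+j<J = ℕ.≤-trans (ℕ.≤-reflexive (lemma (rowCount (suc j)) (j ℕ.* 2)))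
        (ℕ.≤-trans (ℕ.+-monoˡ-≤ (j ℕ.* 2) (gap j 1+j<J)) (tower j (ℕ.<⇒≤ 1+j<J)))
        where
        lemma : ∀ a b → a ℕ.+ (2 ℕ.+ b) ≡ 2 ℕ.+ a ℕ.+ b
        lemma = ℕSolver.solve-∀
      -- Row j is nonempty, so 1 + 2j is at most the count of row 0, hence at most 2h, and j < h.
      ≤J⇒≤h : ∀ n → n ℕ.≤ J → n ℕ.≤ h
      ≤J⇒≤h zero    _   = z≤n
      ≤J⇒≤h (suc j) j<J = ℕ.*-cancelʳ-< 2 j h (ℕ.≤-trans (ℕ.+-monoˡ-≤ (j ℕ.* 2) (rowCount-pos j j<J))
        (ℕ.≤-trans (tower j j<J) rowCount-first))
      J≤h : J ℕ.≤ h
      J≤h = ≤J⇒≤h J ℕ.≤-refl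
      rows≤ : Σ J rowWeight - Σ J (λ j → + rowCount j) * Σ J (λ j → + rowCount j) ≤
        Σ J (λ j → + rowCount j * ((+ 4 * k - + 2) * (+ j + 1ℤ) - + rowCount j)) - Σ J (λ j → + rowCount j) * Σ J (λ j → + rowCount j)
      rows≤ = +-monoˡ-≤ _ (Σ-mono J λ j j<J → rowWeight-bound j (ℕ.≤-trans (ℕ.<⇒≤ j<J) J≤h))
      size≡ : + 12 * + sum (shape χ m) ≡ + 6 * (Σ J rowWeight - Σ J (λ j → + rowCount j) * Σ J (λ j → + rowCount j))
      size≡ = trans (cong (λ ps → + 12 * + sum ps) (sym (shape-stable m≤mw bound)))
        (trans (*-assoc (+ 6) (+ 2) (+ sum (shape χ (m ℕ.* w))))
        (cong (λ z → + 6 * z) (trans (size-Σ χ (m ℕ.* w)) (cong₂ (λ a b → a - b * b) weights counts))))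
        where
        weights : Σ (m ℕ.* w) (λ x → 𝟙 (χ x) * (+ 2 * + x + 1ℤ)) ≡ Σ J rowWeight
        weights = trans (Σ-blocks m w _) (Σ-vanish (beads≤ nonempty m) λ j J≤j _ →
          trans (Σ-cong w λ i i<w → trans
            (cong (λ b → 𝟙 b * (+ 2 * + (i ℕ.+ j ℕ.* w) + 1ℤ)) (beads-none⁻¹ (row j) w (rowCount-zero j J≤j) i i<w))
            (*-zeroˡ (+ 2 * + (i ℕ.+ j ℕ.* w) + 1ℤ)))
          (Σ-zero w))
        counts : Σ (m ℕ.* w) (𝟙 ∘ χ) ≡ Σ J (λ j → + rowCount j)
        counts = trans (Σ-blocks m w _) (trans (Σ-cong m λ j _ → sym (beads-Σ (row j) w))
          (Σ-vanish (beads≤ nonempty m) λ j J≤j _ → cong +_ (rowCount-zero j J≤j)))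
      final : + 6 * (Σ J (λ j → + rowCount j * ((+ 4 * k - + 2) * (+ j + 1ℤ) - + rowCount j)) - Σ J (λ j → + rowCount j) * Σ J (λ j → + rowCount j)) ≤ K
      -- The defect e = h - J puts k into the form 1 + J + e of `rows-bound`.
      final with ℕ.m≤n⇒∃[o]m+o≡n J≤h
      ... | e , J+e≡h = subst
        (λ k → + 6 * (Σ J (λ j → + rowCount j * ((+ 4 * k - + 2) * (+ j + 1ℤ) - + rowCount j)) - Σ J (λ j → + rowCount j) * Σ J (λ j → + rowCount j)) ≤ K)
        k≡ (≤-trans (rows-bound e J rowCount gap width) (≤-reflexive (trans
          (cong (λ k → + 2 * (k * k * (k - 1ℤ) * (k + 1ℤ))) k≡) (lemma H))))
        where
        k≡ : 1ℤ + + J + + e ≡ k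
        k≡ = trans (cong (λ n → 1ℤ + + n) J+e≡h) (+-comm 1ℤ H)
        width : ∀ j → + rowCount j ≤ + 2 * (1ℤ + + J + + e)
        width j = subst (+ rowCount j ≤_) (trans w≡ (cong (λ z → + 2 * z) (sym k≡))) (+≤+ (beads≤ (row j) w))
        lemma : ∀ h → + 2 * ((h + 1ℤ) * (h + 1ℤ) * (h + 1ℤ - 1ℤ) * (h + 1ℤ + 1ℤ)) ≡
          + 2 * ((h + 1ℤ) * (h + 1ℤ) * h * (h + + 2))
        lemma = solve-∀

-- Existence of largest cores and the ratio of their sizes

open import Data.Integer as ℤ using (+_)
import Data.Integer.Properties as ℤ
open import Data.Integer.Tactic.RingSolver using (solve-∀)
open import Data.Nat using (ℕ; suc; _+_; _*_; _∸_; _≤_; _≥_; s≤s; z≤n)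
import Data.Nat.Properties as ℕ
open Beads
open Sums using (quartic)
open Abacus
open TwoCores
open ThreeCores

largest-size-unique : ∀ {P : Partition → Set} μ ν → IsLargest P μ → IsLargest P ν → size μ ≡ size ν
largest-size-unique _ _ (Pμ , μ-max) (Pν , ν-max) = ℕ.≤-antisym (ν-max _ Pμ) (μ-max _ Pν)

module _ (h : ℕ) where

  private
    K = quartic (+ h)
    -- Both windows are a bound on the heights times the number of runners, so they contain every
    -- bead.
    n₂ = (2 + h + suc (h * 2)) * suc (h * 2)
    n₃ = (2 + h * 2) * (2 + h * 2)

  cancel-12 : ∀ {a b} c → + 12 ℤ.* + a ℤ.≤ + c ℤ.* K → + 12 ℤ.* + b ≡ + c ℤ.* K → a ≤ b
  cancel-12 {a} {b} c a≤ b≡ = ℤ.drop‿+≤+ (ℤ.*-cancelˡ-≤-pos (+ a) (+ b) (+ 12) (subst (+ 12 ℤ.* + a ℤ.≤_) (sym b≡) a≤))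

  two-core : Partition
  two-core = toPartition (topSet h) refl n₂

  two-core-largest : IsLargest (Is2Core (1 + h * 2) (3 + h * 2)) two-core
  two-core-largest = (closed⇒core (topSet h) {refl} n₂ (closed-period (topSet-heights h)) , closed⇒core (topSet h) {refl} n₂ (topSet-closed h)) , maximal
    where
    maximal : ∀ μ → Is2Core (1 + h * 2) (3 + h * 2) μ → size μ ≤ size two-core
    maximal μ (core₁ , core₃) with encode μ
    ... | χ , n , enc = cancel-12 8 (subst (λ z → + 12 ℤ.* + z ℤ.≤ + 8 ℤ.* K) (sym size≡)
        (twoCore-bound h zero-gap bounded (closed (s≤s z≤n) core₁) (closed (s≤s z≤n) core₃))) (topSet-size h)
      where open Encodes enc

  three-core : Partition
  three-core = toPartition (tentSet h) refl n₃

  three-core-largest : IsLargest (Is3Core (1 + h * 2) (2 + h * 2) (3 + h * 2)) three-core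
  three-core-largest = (let c₁ , c₂ , c₃ = tentSet-closed h in
    closed⇒core (tentSet h) {refl} n₃ c₁ , closed⇒core (tentSet h) {refl} n₃ c₂ , closed⇒core (tentSet h) {refl} n₃ c₃) , maximal
    where
    maximal : ∀ μ → Is3Core (1 + h * 2) (2 + h * 2) (3 + h * 2) μ → size μ ≤ size three-core
    maximal μ (core₁ , core₂ , core₃) with encode μ
    ... | χ , n , enc = cancel-12 2 (subst (λ z → + 12 ℤ.* + z ℤ.≤ + 2 ℤ.* K) (sym size≡)
        (threeCore-bound h zero-gap (closed (s≤s z≤n) core₁) (closed (s≤s z≤n) core₂) (closed (s≤s z≤n) core₃) bounded)) (tentSet-size h)
      where open Encodes enc

  size-ratio : size two-core ≡ 4 * size three-core
  size-ratio = ℤ.+-injective (ℤ.*-cancelˡ-≡ (+ 12) _ _ (begin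
    + 12 ℤ.* + size two-core              ≡⟨ topSet-size h ⟩
    + 8 ℤ.* K                             ≡⟨ ℤ.*-assoc (+ 4) (+ 2) K ⟩
    + 4 ℤ.* (+ 2 ℤ.* K)                   ≡⟨ cong (+ 4 ℤ.*_) (tentSet-size h) ⟨
    + 4 ℤ.* (+ 12 ℤ.* + size three-core)  ≡⟨ lemma (+ size three-core) ⟩
    + 12 ℤ.* (+ 4 ℤ.* + size three-core)  ≡⟨ cong (+ 12 ℤ.*_) (ℤ.pos-* 4 (size three-core)) ⟨
    + 12 ℤ.* + (4 * size three-core)      ∎))
    where
    open ≡-Reasoning
    lemma : ∀ a → + 4 ℤ.* (+ 12 ℤ.* a) ≡ + 12 ℤ.* (+ 4 ℤ.* a)
    lemma = solve-∀

theorem1p4 : ∀ (k : ℕ) → k ≥ 1 →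
    ((∃ λ κ → IsLargest (Is2Core (2 * k ∸ 1) (2 * k + 1)) κ)
    × (∃ λ κ → IsLargest (Is3Core (2 * k ∸ 1) (2 * k) (2 * k + 1)) κ))
    × (∀ κ κ′ → IsLargest (Is2Core (2 * k ∸ 1) (2 * k + 1)) κ
    → IsLargest (Is3Core (2 * k ∸ 1) (2 * k) (2 * k + 1)) κ′
    → size κ ≡ 4 * size κ′)
theorem1p4 (suc h) _ = for (cong (_∸ 1) (2k≡ h)) (2k≡ h) (trans (ℕ.+-comm (2 * suc h) 1) (cong suc (2k≡ h)))
  where
  2k≡ : ∀ h → 2 * suc h ≡ 2 + h * 2
  2k≡ = ℕSolver.solve-∀
  -- The moduli become variables so that matching on `refl` replaces the expressions in k by their
  -- forms in h = k - 1.
  for : ∀ {a b c} → a ≡ 1 + h * 2 → b ≡ 2 + h * 2 → c ≡ 3 + h * 2 →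
    ((∃ λ κ → IsLargest (Is2Core a c) κ) × (∃ λ κ → IsLargest (Is3Core a b c) κ))
    × (∀ κ κ′ → IsLargest (Is2Core a c) κ → IsLargest (Is3Core a b c) κ′ → size κ ≡ 4 * size κ′)
  for refl refl refl =
    ((two-core h , two-core-largest h) , (three-core h , three-core-largest h)) ,
    λ κ κ′ κ-largest κ′-largest → trans (largest-size-unique κ (two-core h) κ-largest (two-core-largest h))
      (trans (size-ratio h) (cong (4 *_) (largest-size-unique (three-core h) κ′ (three-core-largest h) κ′-largest)))
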